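{- (i) For every $n\le 4$ and all $\lambda,\mu\in\mathbb{Z}^n$, every vertex of the Gelfand--Tsetlin polytope $GT(\lambda,\mu)\subset X_n$ has integer coordinates. (ii) For every $n\ge 5$ there exist $\lambda,\mu\in\mathbb{Z}^n$ such that $GT(\lambda,\mu)\subset X_n$ has a vertex with at least one non-integer coordinate. (iii) By choosing $n$ sufficiently large, one can find GT-polytopes in $X_n$ having vertices with arbitrarily large denominators. Explicitly, for every positive integer $k$, let $$\lambda=(\underbrace{k,\dots,k}_{k},\,k-1,\,\underbrace{0,\dots,0}_{k}),\qquad \mu=(\underbrace{k-1,\dots,k-1}_{k+1},\,\underbrace{1,\dots,1}_{k}),$$ both in $\mathbb{Z}^{2k+1}$. Then $GT(\lambda,\mu)\subset X_{2k+1}$ has a vertex that contains entries with denominator $k$ (when written in lowest terms).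
   Context: For $n\in\mathbb{N}$ (with $n \geq 1$), $X_n$ is the real vector space of all triangular arrays $(x_{ij})_{1\le i\le j\le n}$ with $x_{ij}\in\mathbb{R}$, so $X_n \cong \mathbb{R}^{n(n+1)/2}$. A Gelfand--Tsetlin pattern (GT-pattern) is an array $(x_{ij})_{1\le i\le j\le n}\in X_n$ with $x_{ij}\ge 0$ for $1\le i\le j\le n$ and $x_{i,j+1}\ge x_{ij}\ge x_{i+1,j+1}$ for $1\le i\le j\le n-1$. For $\lambda,\mu\in\mathbb{Z}^n$, the Gelfand--Tsetlin polytope (GT-polytope) $GT(\lambda,\mu)\subset X_n$ is the convex polytope of all GT-patterns $(x_{ij})$ with $x_{in}=\lambda_i$ for $1\le i\le n$, $x_{11}=\mu_1$, and $\sum_{i=1}^{j}x_{ij}-\sum_{i=1}^{j-1}x_{i,j-1}=\mu_j$ for $2\le j\le n$. Since $\lambda,\mu$ are integral, vertices of $GT(\lambda,\mu)$ have rational coordinates. The Berenstein--Kirillov conjecture is the assertion that all vertices of every Gelfand--Tsetlin polytope $GT(\lambda,\mu)$ have integer coordinates; parts (i) and (ii) say that it is true for $n\le 4$ and has counterexamples for every $n\ge 5$. -}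

module Defs where

open import Data.Bool.Base using (if_then_else_)
open import Data.Fin.Base using (Fin; suc; inject₁; toℕ)
open import Data.Fin.Properties using (toℕ<n)
open import Data.Integer.Base as ℤ using (ℤ; 0ℤ; 1ℤ)
open import Data.Nat.Base as ℕ using (ℕ; suc; _≤ᵇ_)
import Data.Nat.Properties as ℕₚ
open import Data.Product.Base using (∃; _×_; _,_)
open import Data.Rational.Base as ℚ
  using (ℚ; 0ℚ; 1ℚ; ½; _+_; _*_; _-_; -_; _<_; _≤_; ∣_∣; 1/_; Positive; positive; ↧ₙ_)
import Data.Rational.Properties as ℚₚ
open import Data.Rational.Solver using (module +-*-Solver)
open import Data.Vec.Functional using (Vector; foldr)
open import Relation.Binary.Definitions using (tri<; tri≈; tri>)
open import Relation.Binary.PropositionalEquality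
  using (_≡_; refl; sym; trans; cong; cong₂; subst)

open +-*-Solver using (solve; _:+_; _:*_; _:-_; :-_; _:=_)

------------------------------------------------------------------------
-- Real numbers: Cauchy sequences of rationals, with the setoid
-- equality _≈ᵣ_.

Cauchy : (ℕ → ℚ) → Set
Cauchy s = ∀ ε → 0ℚ < ε →
  ∃ λ N → ∀ m n → N ℕ.≤ m → N ℕ.≤ n → ∣ s m - s n ∣ < ε

record ℝ : Set where
  constructor mkℝ
  field
    seq    : ℕ → ℚ
    cauchy : Cauchy seq

open ℝ public

-- Abstract, as checking types that unfold these proofs is very slow.
abstract
  +-split : ∀ a b c d → (a + b) - (c + d) ≡ (a - c) + (b - d)
  +-split = solve 4 (λ a b c d → (a :+ b) :- (c :+ d) := (a :- c) :+ (b :- d)) refl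

  *-split : ∀ a b c d → a * b - c * d ≡ a * (b - d) + d * (a - c)
  *-split = solve 4
    (λ a b c d → a :* b :- c :* d := a :* (b :- d) :+ d :* (a :- c)) refl

  neg-split : ∀ a b → (- a) - (- b) ≡ - (a - b)
  neg-split = solve 2 (λ a b → (:- a) :- (:- b) := :- (a :- b)) refl

  via : ∀ a b → a ≡ b + (a - b)
  via = solve 2 (λ a b → a := b :+ (a :- b)) refl

  half-pos : ∀ ε → 0ℚ < ε → 0ℚ < ½ * ε
  half-pos ε ε>0 =
    ℚₚ.positive⁻¹ (½ * ε) {{ℚₚ.pos*pos⇒pos ½ ε {{positive ε>0}}}}

  halves : ∀ ε → ½ * ε + ½ * ε ≡ ε
  halves ε = trans (sym (ℚₚ.*-distribʳ-+ ε ½ ½)) (ℚₚ.*-identityˡ ε)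

  const-cauchy : ∀ q → Cauchy (λ _ → q)
  const-cauchy q ε ε>0 = 0 , λ _ _ _ _ →
    subst (_< ε) (sym (cong ∣_∣ (ℚₚ.+-inverseʳ q))) ε>0

  +-cauchy : ∀ s t → Cauchy s → Cauchy t → Cauchy (λ n → s n + t n)
  +-cauchy s t cs ct ε ε>0
    with cs (½ * ε) (half-pos ε ε>0) | ct (½ * ε) (half-pos ε ε>0)
  ... | M , hs | N , ht = M ℕ.⊔ N , λ m n m≥ n≥ → begin-strict
    ∣ (s m + t m) - (s n + t n) ∣
      ≡⟨ cong ∣_∣ (+-split (s m) (t m) (s n) (t n)) ⟩
    ∣ (s m - s n) + (t m - t n) ∣
      ≤⟨ ℚₚ.∣p+q∣≤∣p∣+∣q∣ (s m - s n) (t m - t n) ⟩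
    ∣ s m - s n ∣ + ∣ t m - t n ∣
      <⟨ ℚₚ.+-mono-<
           (hs m n (ℕₚ.m⊔n≤o⇒m≤o M N m≥) (ℕₚ.m⊔n≤o⇒m≤o M N n≥))
           (ht m n (ℕₚ.m⊔n≤o⇒n≤o M N m≥) (ℕₚ.m⊔n≤o⇒n≤o M N n≥)) ⟩
    ½ * ε + ½ * ε
      ≡⟨ halves ε ⟩
    ε ∎
    where open ℚₚ.≤-Reasoning

  neg-cauchy : ∀ s → Cauchy s → Cauchy (λ n → - s n)
  neg-cauchy s cs ε ε>0 with cs ε ε>0
  ... | N , hs = N , λ m n m≥ n≥ → begin-strict
    ∣ (- s m) - (- s n) ∣
      ≡⟨ cong ∣_∣ (neg-split (s m) (s n)) ⟩
    ∣ - (s m - s n) ∣  ≡⟨ ℚₚ.∣-p∣≡∣p∣ (s m - s n) ⟩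
    ∣ s m - s n ∣      <⟨ hs m n m≥ n≥ ⟩
    ε ∎
    where open ℚₚ.≤-Reasoning

  eventually-bounded : ∀ {s} → Cauchy s →
    ∃ λ B → Positive B × ∃ λ N → ∀ n → N ℕ.≤ n → ∣ s n ∣ ≤ B
  eventually-bounded {s} cs with cs 1ℚ (ℚₚ.positive⁻¹ 1ℚ)
  ... | N , hs =
    ∣ s N ∣ + 1ℚ
    , ℚₚ.nonNeg+pos⇒pos ∣ s N ∣ {{ℚₚ.∣-∣-nonNeg (s N)}} 1ℚ
    , N
    , λ n n≥ → begin
      ∣ s n ∣
        ≡⟨ cong ∣_∣ (via (s n) (s N)) ⟩
      ∣ s N + (s n - s N) ∣
        ≤⟨ ℚₚ.∣p+q∣≤∣p∣+∣q∣ (s N) (s n - s N) ⟩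
      ∣ s N ∣ + ∣ s n - s N ∣
        ≤⟨ ℚₚ.+-monoʳ-≤ ∣ s N ∣ (ℚₚ.<⇒≤ (hs n N n≥ ℕₚ.≤-refl)) ⟩
      ∣ s N ∣ + 1ℚ ∎
    where open ℚₚ.≤-Reasoning

  divide : ∀ B ε → Positive B → 0ℚ < ε → ∃ λ δ → 0ℚ < δ × B * δ ≡ ε
  divide B ε B>0 ε>0 = 1/ B * ε , ℚₚ.positive⁻¹ (1/ B * ε)
    {{ℚₚ.pos*pos⇒pos (1/ B) {{ℚₚ.1/pos⇒pos B {{B>0}}}} ε {{positive ε>0}}}} ,
    trans (sym (ℚₚ.*-assoc B (1/ B) ε))
      (trans (cong (_* ε) (ℚₚ.*-inverseʳ B)) (ℚₚ.*-identityˡ ε))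
    where
    instance
      B≢0 : ℚ.NonZero B
      B≢0 = ℚₚ.pos⇒nonZero B {{B>0}}

  ∣*∣-< : ∀ {B δ} a d → Positive B → ∣ a ∣ ≤ B → ∣ d ∣ < δ → ∣ a * d ∣ < B * δ
  ∣*∣-< {B} {δ} a d B>0 a≤B d<δ = begin-strict
    ∣ a * d ∣      ≡⟨ ℚₚ.∣p*q∣≡∣p∣*∣q∣ a d ⟩
    ∣ a ∣ * ∣ d ∣  ≤⟨ ℚₚ.*-monoʳ-≤-nonNeg ∣ d ∣ {{ℚₚ.∣-∣-nonNeg d}} a≤B ⟩
    B * ∣ d ∣      <⟨ ℚₚ.*-monoʳ-<-pos B {{B>0}} d<δ ⟩
    B * δ ∎
    where open ℚₚ.≤-Reasoning

  *-estimate : ∀ {A B δ η} a b c d → Positive A → Positive B →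
    ∣ a ∣ ≤ A → ∣ d ∣ ≤ B → ∣ b - d ∣ < δ → ∣ a - c ∣ < η →
    ∣ a * b - c * d ∣ < A * δ + B * η
  *-estimate {A} {B} {δ} {η} a b c d A>0 B>0 a≤A d≤B b-d<δ a-c<η = begin-strict
    ∣ a * b - c * d ∣
      ≡⟨ cong ∣_∣ (*-split a b c d) ⟩
    ∣ a * (b - d) + d * (a - c) ∣
      ≤⟨ ℚₚ.∣p+q∣≤∣p∣+∣q∣ (a * (b - d)) (d * (a - c)) ⟩
    ∣ a * (b - d) ∣ + ∣ d * (a - c) ∣
      <⟨ ℚₚ.+-mono-< (∣*∣-< a (b - d) A>0 a≤A b-d<δ) (∣*∣-< d (a - c) B>0 d≤B a-c<η) ⟩
    A * δ + B * η ∎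
    where open ℚₚ.≤-Reasoning

  *-cauchy : ∀ s t → Cauchy s → Cauchy t → Cauchy (λ n → s n * t n)
  *-cauchy s t cs ct ε ε>0 =
    let A , A>0 , K , hA = eventually-bounded cs
        B , B>0 , L , hB = eventually-bounded ct
        δ , δ>0 , Aδ≡    = divide A (½ * ε) A>0 (half-pos ε ε>0)
        η , η>0 , Bη≡    = divide B (½ * ε) B>0 (half-pos ε ε>0)
        M , ht           = ct δ δ>0
        N , hs           = cs η η>0
        left : ∀ {n} → (K ℕ.⊔ L) ℕ.⊔ (M ℕ.⊔ N) ℕ.≤ n → K ℕ.⊔ L ℕ.≤ n
        left  = ℕₚ.m⊔n≤o⇒m≤o (K ℕ.⊔ L) (M ℕ.⊔ N)
        right : ∀ {n} → (K ℕ.⊔ L) ℕ.⊔ (M ℕ.⊔ N) ℕ.≤ n → M ℕ.⊔ N ℕ.≤ n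
        right = ℕₚ.m⊔n≤o⇒n≤o (K ℕ.⊔ L) (M ℕ.⊔ N)
    in (K ℕ.⊔ L) ℕ.⊔ (M ℕ.⊔ N) , λ m n m≥ n≥ →
      subst (∣ s m * t m - s n * t n ∣ <_)
        (trans (cong₂ _+_ Aδ≡ Bη≡) (halves ε))
        (*-estimate (s m) (t m) (s n) (t n) A>0 B>0
          (hA m (ℕₚ.m⊔n≤o⇒m≤o K L (left m≥)))
          (hB n (ℕₚ.m⊔n≤o⇒n≤o K L (left n≥)))
          (ht m n (ℕₚ.m⊔n≤o⇒m≤o M N (right m≥)) (ℕₚ.m⊔n≤o⇒m≤o M N (right n≥)))
          (hs m n (ℕₚ.m⊔n≤o⇒n≤o M N (right m≥)) (ℕₚ.m⊔n≤o⇒n≤o M N (right n≥))))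

infix  4 _≈ᵣ_ _≤ᵣ_ _<ᵣ_
infixl 6 _+ᵣ_ _-ᵣ_
infixl 7 _*ᵣ_
infix  8 -ᵣ_

record _≈ᵣ_ (x y : ℝ) : Set where
  constructor mk≈
  field
    close : ∀ ε → 0ℚ < ε → ∃ λ N → ∀ n → N ℕ.≤ n → ∣ seq x n - seq y n ∣ < ε

record _≤ᵣ_ (x y : ℝ) : Set where
  constructor mk≤
  field
    below : ∀ ε → 0ℚ < ε → ∃ λ N → ∀ n → N ℕ.≤ n → seq x n < seq y n + ε

record _<ᵣ_ (x y : ℝ) : Set where
  constructor mk<
  field
    gap : ∃ λ ε → 0ℚ < ε × ∃ λ N → ∀ n → N ℕ.≤ n → seq x n + ε < seq y n

open _≈ᵣ_ public
open _≤ᵣ_ public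
open _<ᵣ_ public

fromℚ : ℚ → ℝ
fromℚ q = mkℝ (λ _ → q) (const-cauchy q)

fromℤ : ℤ → ℝ
fromℤ z = fromℚ (z ℚ./ 1)

0ᵣ 1ᵣ : ℝ
0ᵣ = fromℤ 0ℤ
1ᵣ = fromℤ 1ℤ

-ᵣ_ : ℝ → ℝ
-ᵣ x = mkℝ (λ n → - seq x n) (neg-cauchy (seq x) (cauchy x))

_+ᵣ_ _-ᵣ_ _*ᵣ_ : ℝ → ℝ → ℝ
x +ᵣ y = mkℝ (λ n → seq x n + seq y n) (+-cauchy (seq x) (seq y) (cauchy x) (cauchy y))
_-ᵣ_ x y = x +ᵣ (-ᵣ y)
x *ᵣ y = mkℝ (λ n → seq x n * seq y n) (*-cauchy (seq x) (seq y) (cauchy x) (cauchy y))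

sum : ∀ {n} → Vector ℝ n → ℝ
sum = foldr _+ᵣ_ 0ᵣ

IsInteger : ℝ → Set
IsInteger x = ∃ λ z → x ≈ᵣ fromℤ z

-- The fields of a ℚ are coprime, so ↧ₙ is the denominator in lowest terms.
HasDenominator : ℝ → ℕ → Set
HasDenominator x d = ∃ λ q → x ≈ᵣ fromℚ q × ↧ₙ q ≡ d

------------------------------------------------------------------------
-- Triangular arrays

-- Row j consists of x₁ⱼ, …, xⱼⱼ: with h : j ≤ n, the entry xᵢⱼ is x j h at
-- the element i - 1 of Fin j.  There is also an empty row 0, which carries
-- no data.
X : ℕ → Set
X n = (j : ℕ) → .(j ℕ.≤ n) → Vector ℝ j

infix 4 _≋_

_≋_ : ∀ {n} → X n → X n → Set
_≋_ {n} x y = ∀ j .(h : j ℕ.≤ n) i → x j h i ≈ᵣ y j h i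

-- (1 - t) y + t z
segment : ∀ {n} → ℝ → X n → X n → X n
segment t y z j h i = (1ᵣ -ᵣ t) *ᵣ y j h i +ᵣ t *ᵣ z j h i

-- A vertex of a convex polytope is an extreme point: a point of it that lies
-- in no open segment between two distinct points of it.
IsVertex : ∀ {n} → (X n → Set) → X n → Set
IsVertex P x = P x ×
  (∀ y z → P y → P z → ∀ t → 0ᵣ <ᵣ t → t <ᵣ 1ᵣ → x ≋ segment t y z → y ≋ z)

------------------------------------------------------------------------
-- Gelfand–Tsetlin polytopes

record IsGTPattern {n : ℕ} (x : X n) : Set where
  field
    nonneg : ∀ j .(h : j ℕ.≤ n) i → 0ᵣ ≤ᵣ x j h i
    upper  : ∀ j .(h : suc j ℕ.≤ n) (i : Fin j) →
             x j (ℕₚ.<⇒≤ h) i ≤ᵣ x (suc j) h (inject₁ i)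
    lower  : ∀ j .(h : suc j ℕ.≤ n) (i : Fin j) →
             x (suc j) h (suc i) ≤ᵣ x j (ℕₚ.<⇒≤ h) i

-- As row 0 is empty, the instance of weight at the first index says x₁₁ = μ₁.
record GT {n : ℕ} (λs μs : Vector ℤ n) (x : X n) : Set where
  field
    isPattern : IsGTPattern x
    top       : ∀ i → x n ℕₚ.≤-refl i ≈ᵣ fromℤ (λs i)
    weight    : ∀ (j : Fin n) →
                sum (x (suc (toℕ j)) (toℕ<n j)) -ᵣ sum (x (toℕ j) (ℕₚ.<⇒≤ (toℕ<n j)))
                  ≈ᵣ fromℤ (μs j)

-- (k, …, k, k - 1, 0, …, 0) with k copies of k and k copies of 0.
λᵏ : ∀ k → Vector ℤ (2 ℕ.* k ℕ.+ 1)
λᵏ k i with ℕₚ.<-cmp (toℕ i) k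
... | tri< _ _ _ = ℤ.+ k
... | tri≈ _ _ _ = ℤ.+ k ℤ.- 1ℤ
... | tri> _ _ _ = 0ℤ

-- (k - 1, …, k - 1, 1, …, 1) with k + 1 copies of k - 1 and k copies of 1.
μᵏ : ∀ k → Vector ℤ (2 ℕ.* k ℕ.+ 1)
μᵏ k i = if toℕ i ≤ᵇ k then ℤ.+ k ℤ.- 1ℤ else 1ℤ

{-# OPTIONS --safe #-}
module Submission where

-- (i) At a vertex no direction d ≠ 0 respects the row sums and the tight constraints, since x ± ε d
-- would both lie in the polytope for small ε.  For n ≤ 4 a non-integer entry yields such a direction
-- with entries in {-1, 0, 1}.  Being an integer is ¬¬-stable for Cauchy reals, so this argument may
-- decide equalities of reals freely.
--
-- (ii), (iii) Conversely, a point is a vertex if the constraints tight at it determine it.  With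
-- b = (k² - 1) / k, row j of the vertex used here is
--
--   b, …, b, (k + 1 - j)(k - 1) / k                           for j ≤ k + 1 (j - 1 copies of b),
--   k, …, k, b, …, b, r (k - 1) / k, 0, …, 0                  for j = k + 1 + r, r ≤ k
--                                                             (r copies of k, k - r of b, r of 0).
--
-- The entries b are all linked by tight constraints, those equal to k are linked to the top row, and
-- the zeros are tight.  Row k + 1 consists of k copies of b and a 0, so its sum determines b, and the
-- remaining entry of every other row follows from the row sum.  Repeating row 2 k + 1, padded with
-- zeros, gives such vertices for all n ≥ 2 k + 1.

open import Defs
open import Data.Bool.Base using (true; false)
open import Data.Empty using (⊥; ⊥-elim; ⊥-elim-irr)
open import Data.Fin.Base using (Fin; zero; suc; inject₁; toℕ; fromℕ<)
open import Data.Fin.Induction using (<-weakInduction)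
open import Data.Fin.Properties
  using (toℕ<n; toℕ-fromℕ<; toℕ-injective; toℕ-inject₁; toℕ≤pred[n])
open import Data.Integer.Base as ℤ using (ℤ; 0ℤ; 1ℤ; +_)
import Data.Integer.DivMod as ℤd
open import Data.Integer.GCD using (gcd)
import Data.Integer.Properties as ℤₚ
open import Data.Integer.Solver using () renaming (module +-*-Solver to ℤ-Solver)
open import Data.Nat.Base as ℕ
  using (ℕ; zero; suc; _≤_; _<_; _+_; _*_; _∸_; _⊓_; _⊔_; s≤s; z≤n; z<s; s<s)
open import Data.Nat.Coprimality using (Coprime)
open import Data.Nat.Divisibility using (_∣_; ∣1⇒≡1; ∣m+n∣m⇒∣n; ∣m⇒∣m*n)
import Data.Nat.Properties as ℕₚ
open import Data.Nat.Solver using () renaming (module +-*-Solver to ℕ-Solver)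
open import Data.Product.Base using (∃; _×_; _,_; proj₁; proj₂)
open import Data.Rational.Base as ℚ using (ℚ; 0ℚ; 1ℚ; ½; mkℚ; toℚᵘ)
import Data.Rational.Properties as ℚₚ
open import Data.Rational.Solver using (module +-*-Solver)
open import Data.Rational.Unnormalised.Base as ℚᵘ using (mkℚᵘ; *≡*; *<*; *≤*)
import Data.Rational.Unnormalised.Properties as ℚᵘₚ
open import Data.Sum.Base using (_⊎_; inj₁; inj₂)
open import Data.Vec.Functional using (Vector; foldr)
open import Function.Base using (_∘_; _$_)
open import Relation.Binary.Definitions using (tri<; tri≈; tri>)
open import Relation.Binary.PropositionalEquality
  using (_≡_; _≢_; refl; sym; trans; cong; cong₂; subst; subst₂; module ≡-Reasoning)
open import Relation.Nullary.Decidable.Core using (yes; no; recompute)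
open import Relation.Nullary.Negation.Core using (¬_; contradiction)
open import Relation.Nullary.Reflects using (ofʸ; ofⁿ)

open +-*-Solver using (solve; _:+_; _:*_; _:-_; :-_; _:=_; con)

-- Order and equality of Cauchy reals

Eventually : (ℕ → Set) → Set
Eventually P = ∃ λ N → ∀ n → N ≤ n → P n

always : ∀ {P} → (∀ n → P n) → Eventually P
always p = 0 , λ n _ → p n

eventually₁ : ∀ {P Q} → (∀ {n} → P n → Q n) → Eventually P → Eventually Q
eventually₁ f (N , p) = N , λ n n≥ → f (p n n≥)

eventually₂ : ∀ {P Q R} → (∀ {n} → P n → Q n → R n) →
  Eventually P → Eventually Q → Eventually R
eventually₂ f (M , p) (N , q) = M ⊔ N , λ n n≥ →
  f (p n (ℕₚ.m⊔n≤o⇒m≤o M N n≥)) (q n (ℕₚ.m⊔n≤o⇒n≤o M N n≥))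

abstract
  -- The hypothesis says b - a ≡ d - c, without subtractions.
  lin-< : ∀ {c d} a b → c ℚ.< d → a ℚ.+ d ≡ b ℚ.+ c → a ℚ.< b
  lin-< {c} {d} a b c<d eq = subst₂ ℚ._<_
    (solve 2 (λ a c → (a :+ c) :+ (:- c) := a) refl a c)
    (trans (cong (ℚ._+ ℚ.- c) eq) (solve 2 (λ b c → (b :+ c) :+ (:- c) := b) refl b c))
    (ℚₚ.+-monoˡ-< (ℚ.- c) (ℚₚ.+-monoʳ-< a c<d))

  lin-≤ : ∀ {c d} a b → c ℚ.≤ d → a ℚ.+ d ≡ b ℚ.+ c → a ℚ.≤ b
  lin-≤ {c} {d} a b c≤d eq = subst₂ ℚ._≤_
    (solve 2 (λ a c → (a :+ c) :+ (:- c) := a) refl a c)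
    (trans (cong (ℚ._+ ℚ.- c) eq) (solve 2 (λ b c → (b :+ c) :+ (:- c) := b) refl b c))
    (ℚₚ.+-monoˡ-≤ (ℚ.- c) (ℚₚ.+-monoʳ-≤ a c≤d))

  p≤∣p∣ : ∀ p → p ℚ.≤ ℚ.∣ p ∣
  p≤∣p∣ p with ℚₚ.≤-total 0ℚ p
  ... | inj₁ 0≤p = ℚₚ.≤-reflexive (sym (ℚₚ.0≤p⇒∣p∣≡p 0≤p))
  ... | inj₂ p≤0 = ℚₚ.≤-trans p≤0 (ℚₚ.0≤∣p∣ p)

  -p≤∣p∣ : ∀ p → ℚ.- p ℚ.≤ ℚ.∣ p ∣
  -p≤∣p∣ p = subst (ℚ.- p ℚ.≤_) (ℚₚ.∣-p∣≡∣p∣ p) (p≤∣p∣ (ℚ.- p))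

  ∣p-q∣<ε⇒p<q+ε : ∀ p q {ε} → ℚ.∣ p ℚ.- q ∣ ℚ.< ε → p ℚ.< q ℚ.+ ε
  ∣p-q∣<ε⇒p<q+ε p q {ε} h = lin-< p (q ℚ.+ ε) (ℚₚ.≤-<-trans (p≤∣p∣ (p ℚ.- q)) h)
    (solve 3 (λ p q ε → p :+ ε := (q :+ ε) :+ (p :- q)) refl p q ε)

  ∣p-q∣<ε⇒q<p+ε : ∀ p q {ε} → ℚ.∣ p ℚ.- q ∣ ℚ.< ε → q ℚ.< p ℚ.+ ε
  ∣p-q∣<ε⇒q<p+ε p q {ε} h = lin-< q (p ℚ.+ ε) (ℚₚ.≤-<-trans (-p≤∣p∣ (p ℚ.- q)) h)
    (solve 3 (λ p q ε → q :+ ε := (p :+ ε) :+ :- (p :- q)) refl p q ε)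

  <⇒∣p-q∣<ε : ∀ p q {ε} → p ℚ.< q ℚ.+ ε → q ℚ.< p ℚ.+ ε → ℚ.∣ p ℚ.- q ∣ ℚ.< ε
  <⇒∣p-q∣<ε p q {ε} p<q+ε q<p+ε with ℚₚ.∣p∣≡p∨∣p∣≡-p (p ℚ.- q)
  ... | inj₁ eq = subst (ℚ._< ε) (sym eq) (lin-< (p ℚ.- q) ε p<q+ε
    (solve 3 (λ p q ε → (p :- q) :+ (q :+ ε) := ε :+ p) refl p q ε))
  ... | inj₂ eq = subst (ℚ._< ε) (sym eq) (lin-< (ℚ.- (p ℚ.- q)) ε q<p+ε
    (solve 3 (λ p q ε → :- (p :- q) :+ (p :+ ε) := ε :+ q) refl p q ε))

  p<p+ε : ∀ p {ε} → 0ℚ ℚ.< ε → p ℚ.< p ℚ.+ ε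
  p<p+ε p {ε} 0<ε = lin-< p (p ℚ.+ ε) 0<ε (sym (ℚₚ.+-identityʳ (p ℚ.+ ε)))

≤-pointwise : ∀ {x y} → (∀ n → seq x n ℚ.≤ seq y n) → x ≤ᵣ y
≤-pointwise h = mk≤ λ ε 0<ε → always λ n → ℚₚ.≤-<-trans (h n) (p<p+ε _ 0<ε)

≤ᵣ-trans : ∀ {x y z} → x ≤ᵣ y → y ≤ᵣ z → x ≤ᵣ z
≤ᵣ-trans {x} {y} {z} x≤y y≤z = mk≤ λ ε 0<ε →
  eventually₂ {λ n → seq x n ℚ.< seq y n ℚ.+ ½ ℚ.* ε} {λ n → seq y n ℚ.< seq z n ℚ.+ ½ ℚ.* ε}
    (λ {n} p q → lin-< (seq x n) (seq z n ℚ.+ ε) (ℚₚ.+-mono-< p q) (eq (seq x n) (seq y n) (seq z n) ε))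
    (below x≤y _ (half-pos ε 0<ε)) (below y≤z _ (half-pos ε 0<ε))
  where
  abstract
    eq : ∀ x y z ε → x ℚ.+ ((y ℚ.+ ½ ℚ.* ε) ℚ.+ (z ℚ.+ ½ ℚ.* ε)) ≡ (z ℚ.+ ε) ℚ.+ (x ℚ.+ y)
    eq = solve 4 (λ x y z ε → x :+ ((y :+ con ½ :* ε) :+ (z :+ con ½ :* ε)) := (z :+ ε) :+ (x :+ y)) refl

≈⇒≤ : ∀ {x y} → x ≈ᵣ y → x ≤ᵣ y
≈⇒≤ {x} {y} x≈y = mk≤ λ ε 0<ε → eventually₁ {λ n → ℚ.∣ seq x n ℚ.- seq y n ∣ ℚ.< ε}
  (λ {n} → ∣p-q∣<ε⇒p<q+ε (seq x n) (seq y n)) (close x≈y ε 0<ε)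

≈⇒≥ : ∀ {x y} → x ≈ᵣ y → y ≤ᵣ x
≈⇒≥ {x} {y} x≈y = mk≤ λ ε 0<ε → eventually₁ {λ n → ℚ.∣ seq x n ℚ.- seq y n ∣ ℚ.< ε}
  (λ {n} → ∣p-q∣<ε⇒q<p+ε (seq x n) (seq y n)) (close x≈y ε 0<ε)

≤ᵣ-antisym : ∀ {x y} → x ≤ᵣ y → y ≤ᵣ x → x ≈ᵣ y
≤ᵣ-antisym {x} {y} x≤y y≤x = mk≈ λ ε 0<ε →
  eventually₂ {λ n → seq x n ℚ.< seq y n ℚ.+ ε} {λ n → seq y n ℚ.< seq x n ℚ.+ ε}
    (λ {n} → <⇒∣p-q∣<ε (seq x n) (seq y n)) (below x≤y ε 0<ε) (below y≤x ε 0<ε)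

≈-pointwise : ∀ {x y} → (∀ n → seq x n ≡ seq y n) → x ≈ᵣ y
≈-pointwise h = ≤ᵣ-antisym (≤-pointwise λ n → ℚₚ.≤-reflexive (h n))
  (≤-pointwise λ n → ℚₚ.≤-reflexive (sym (h n)))

≈-refl : ∀ {x} → x ≈ᵣ x
≈-refl = ≈-pointwise λ _ → refl

≈-sym : ∀ {x y} → x ≈ᵣ y → y ≈ᵣ x
≈-sym x≈y = ≤ᵣ-antisym (≈⇒≥ x≈y) (≈⇒≤ x≈y)

≈-trans : ∀ {x y z} → x ≈ᵣ y → y ≈ᵣ z → x ≈ᵣ z
≈-trans x≈y y≈z = ≤ᵣ-antisym (≤ᵣ-trans (≈⇒≤ x≈y) (≈⇒≤ y≈z)) (≤ᵣ-trans (≈⇒≥ y≈z) (≈⇒≥ x≈y))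

+-mono-≤ᵣ : ∀ {x y u v} → x ≤ᵣ y → u ≤ᵣ v → x +ᵣ u ≤ᵣ y +ᵣ v
+-mono-≤ᵣ {x} {y} {u} {v} x≤y u≤v = mk≤ λ ε 0<ε →
  eventually₂ {λ n → seq x n ℚ.< seq y n ℚ.+ ½ ℚ.* ε} {λ n → seq u n ℚ.< seq v n ℚ.+ ½ ℚ.* ε}
    (λ {n} p q → lin-< _ _ (ℚₚ.+-mono-< p q) (eq (seq x n) (seq y n) (seq u n) (seq v n) ε))
    (below x≤y _ (half-pos ε 0<ε)) (below u≤v _ (half-pos ε 0<ε))
  where
  abstract
    eq : ∀ x y u v ε → (x ℚ.+ u) ℚ.+ ((y ℚ.+ ½ ℚ.* ε) ℚ.+ (v ℚ.+ ½ ℚ.* ε)) ≡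
         ((y ℚ.+ v) ℚ.+ ε) ℚ.+ (x ℚ.+ u)
    eq = solve 5 (λ x y u v ε → (x :+ u) :+ ((y :+ con ½ :* ε) :+ (v :+ con ½ :* ε)) :=
         ((y :+ v) :+ ε) :+ (x :+ u)) refl

-‿anti-≤ : ∀ {x y} → x ≤ᵣ y → -ᵣ y ≤ᵣ -ᵣ x
-‿anti-≤ {x} {y} x≤y = mk≤ λ ε 0<ε →
  eventually₁ {λ n → seq x n ℚ.< seq y n ℚ.+ ε}
    (λ {n} p → lin-< _ _ p (eq (seq x n) (seq y n) ε)) (below x≤y ε 0<ε)
  where
  abstract
    eq : ∀ x y ε → (ℚ.- y) ℚ.+ (y ℚ.+ ε) ≡ ((ℚ.- x) ℚ.+ ε) ℚ.+ x
    eq = solve 3 (λ x y ε → (:- y) :+ (y :+ ε) := ((:- x) :+ ε) :+ x) refl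

+-cong : ∀ {x y u v} → x ≈ᵣ y → u ≈ᵣ v → x +ᵣ u ≈ᵣ y +ᵣ v
+-cong p q = ≤ᵣ-antisym (+-mono-≤ᵣ (≈⇒≤ p) (≈⇒≤ q)) (+-mono-≤ᵣ (≈⇒≥ p) (≈⇒≥ q))

-‿cong : ∀ {x y} → x ≈ᵣ y → -ᵣ x ≈ᵣ -ᵣ y
-‿cong p = ≤ᵣ-antisym (-‿anti-≤ (≈⇒≥ p)) (-‿anti-≤ (≈⇒≤ p))

sub-cong : ∀ {x y u v} → x ≈ᵣ y → u ≈ᵣ v → x -ᵣ u ≈ᵣ y -ᵣ v
sub-cong p q = +-cong p (-‿cong q)

x+[y-x]≈y : ∀ x y → x +ᵣ (y -ᵣ x) ≈ᵣ y
x+[y-x]≈y x y = ≈-pointwise λ n → solve 2 (λ x y → x :+ (y :- x) := y) refl (seq x n) (seq y n)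

[x+y]-x≈y : ∀ x y → (x +ᵣ y) -ᵣ x ≈ᵣ y
[x+y]-x≈y x y = ≈-pointwise λ n → solve 2 (λ x y → (x :+ y) :- x := y) refl (seq x n) (seq y n)

[x+y]-y≈x : ∀ x y → (x +ᵣ y) -ᵣ y ≈ᵣ x
[x+y]-y≈x x y = ≈-pointwise λ n → solve 2 (λ x y → (x :+ y) :- y := x) refl (seq x n) (seq y n)

+-cancelˡ : ∀ {x y u v} → x ≈ᵣ y → x +ᵣ u ≈ᵣ y +ᵣ v → u ≈ᵣ v
+-cancelˡ {x} {y} {u} {v} x≈y h =
  ≈-trans (≈-sym ([x+y]-x≈y x u)) (≈-trans (sub-cong h x≈y) ([x+y]-x≈y y v))

+-cancelʳ : ∀ {x y u v} → u ≈ᵣ v → x +ᵣ u ≈ᵣ y +ᵣ v → x ≈ᵣ y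
+-cancelʳ {x} {y} {u} {v} u≈v h =
  ≈-trans (≈-sym ([x+y]-y≈x x u)) (≈-trans (sub-cong h u≈v) ([x+y]-y≈x y v))

sum-cong : ∀ {n} {u v : Vector ℝ n} → (∀ i → u i ≈ᵣ v i) → sum u ≈ᵣ sum v
sum-cong {zero} h = ≈-refl
sum-cong {suc n} h = +-cong (h zero) (sum-cong (λ i → h (suc i)))

-- One late pair of terms decides. If `y` exceeds `x` there by `ε/2`, the Cauchy bounds `ε/8` leave
-- a gap of `ε/4` for good, so `x <ᵣ y`. Otherwise `y` stays below `x + ε` from there on.
≮⇒≥ : ∀ {x y} → ¬ (x <ᵣ y) → y ≤ᵣ x
≮⇒≥ {x} {y} x≮y = mk≤ bound
  where
  abstract
    eq₁ : ∀ x y x₀ y₀ ε →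
      (x ℚ.+ ½ ℚ.* (½ ℚ.* ε)) ℚ.+
        (((x₀ ℚ.+ ½ ℚ.* (½ ℚ.* (½ ℚ.* ε))) ℚ.+ (y ℚ.+ ½ ℚ.* (½ ℚ.* (½ ℚ.* ε)))) ℚ.+ y₀) ≡
      y ℚ.+ ((x ℚ.+ y₀) ℚ.+ (x₀ ℚ.+ ½ ℚ.* ε))
    eq₁ = solve 5 (λ x y x₀ y₀ ε →
      (x :+ con ½ :* (con ½ :* ε)) :+
        (((x₀ :+ con ½ :* (con ½ :* (con ½ :* ε))) :+ (y :+ con ½ :* (con ½ :* (con ½ :* ε)))) :+ y₀) :=
      y :+ ((x :+ y₀) :+ (x₀ :+ con ½ :* ε))) refl

    eq₂ : ∀ x y x₀ y₀ ε →
      y ℚ.+ (((y₀ ℚ.+ ½ ℚ.* (½ ℚ.* (½ ℚ.* ε))) ℚ.+ (x ℚ.+ ½ ℚ.* (½ ℚ.* (½ ℚ.* ε)))) ℚ.+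
        ((x₀ ℚ.+ ½ ℚ.* ε) ℚ.+ ½ ℚ.* (½ ℚ.* ε))) ≡
      (x ℚ.+ ε) ℚ.+ ((y ℚ.+ x₀) ℚ.+ y₀)
    eq₂ = solve 5 (λ x y x₀ y₀ ε →
      y :+ (((y₀ :+ con ½ :* (con ½ :* (con ½ :* ε))) :+ (x :+ con ½ :* (con ½ :* (con ½ :* ε)))) :+
        ((x₀ :+ con ½ :* ε) :+ con ½ :* (con ½ :* ε))) :=
      (x :+ ε) :+ ((y :+ x₀) :+ y₀)) refl

  bound : ∀ ε → 0ℚ ℚ.< ε → Eventually λ n → seq y n ℚ.< seq x n ℚ.+ ε
  bound ε 0<ε with half-pos _ (half-pos _ (half-pos ε 0<ε))
  ... | 0<δ with cauchy x _ 0<δ | cauchy y _ 0<δ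
  ... | M , hx | N , hy with seq x (M ⊔ N) ℚ.+ ½ ℚ.* ε ℚₚ.≤? seq y (M ⊔ N)
  ... | yes le = contradiction
    (mk< (½ ℚ.* (½ ℚ.* ε) , half-pos _ (half-pos ε 0<ε) , M ⊔ N , λ n n≥ →
      lin-< _ _
        (ℚₚ.+-mono-<-≤
          (ℚₚ.+-mono-<
            (∣p-q∣<ε⇒p<q+ε (seq x n) (seq x (M ⊔ N))
              (hx n (M ⊔ N) (ℕₚ.m⊔n≤o⇒m≤o M N n≥) (ℕₚ.m≤m⊔n M N)))
            (∣p-q∣<ε⇒q<p+ε (seq y n) (seq y (M ⊔ N))
              (hy n (M ⊔ N) (ℕₚ.m⊔n≤o⇒n≤o M N n≥) (ℕₚ.m≤n⊔m M N))))
          le)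
        (eq₁ (seq x n) (seq y n) (seq x (M ⊔ N)) (seq y (M ⊔ N)) ε)))
    x≮y
  ... | no nle = M ⊔ N , λ n n≥ →
      lin-< _ _
        (ℚₚ.+-mono-<
          (ℚₚ.+-mono-<
            (∣p-q∣<ε⇒p<q+ε (seq y n) (seq y (M ⊔ N))
              (hy n (M ⊔ N) (ℕₚ.m⊔n≤o⇒n≤o M N n≥) (ℕₚ.m≤n⊔m M N)))
            (∣p-q∣<ε⇒q<p+ε (seq x n) (seq x (M ⊔ N))
              (hx n (M ⊔ N) (ℕₚ.m⊔n≤o⇒m≤o M N n≥) (ℕₚ.m≤m⊔n M N))))
          (ℚₚ.<-trans (ℚₚ.≰⇒> nle) (p<p+ε (seq x (M ⊔ N) ℚ.+ ½ ℚ.* ε) (half-pos _ (half-pos ε 0<ε)))))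
        (eq₂ (seq x n) (seq y n) (seq x (M ⊔ N)) (seq y (M ⊔ N)) ε)

-- Fractions, rounding and stability of integrality

/-+ : ∀ i j m → (i ℚ./ suc m) ℚ.+ (j ℚ./ suc m) ≡ (i ℤ.+ j) ℚ./ suc m
/-+ i j m = ℚₚ.toℚᵘ-injective (begin
  toℚᵘ ((i ℚ./ suc m) ℚ.+ (j ℚ./ suc m))
    ≈⟨ ℚₚ.toℚᵘ-homo-+ (i ℚ./ suc m) (j ℚ./ suc m) ⟩
  toℚᵘ (i ℚ./ suc m) ℚᵘ.+ toℚᵘ (j ℚ./ suc m)
    ≈⟨ ℚᵘₚ.+-cong (ℚₚ.toℚᵘ-fromℚᵘ (mkℚᵘ i m)) (ℚₚ.toℚᵘ-fromℚᵘ (mkℚᵘ j m)) ⟩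
  mkℚᵘ i m ℚᵘ.+ mkℚᵘ j m
    ≈⟨ *≡* (solve-ℤ i j (+ suc m)) ⟩
  mkℚᵘ (i ℤ.+ j) m
    ≈⟨ ℚₚ.toℚᵘ-fromℚᵘ (mkℚᵘ (i ℤ.+ j) m) ⟨
  toℚᵘ ((i ℤ.+ j) ℚ./ suc m) ∎)
  where
  open ℚᵘₚ.≃-Reasoning
  solve-ℤ : ∀ i j d → (i ℤ.* d ℤ.+ j ℤ.* d) ℤ.* d ≡ (i ℤ.+ j) ℤ.* (d ℤ.* d)
  solve-ℤ = ℤ-Solver.solve 3 (λ i j d → (i ⊗ d ⊕ j ⊗ d) ⊗ d ⊜ (i ⊕ j) ⊗ (d ⊗ d)) refl
    where open ℤ-Solver renaming (_:+_ to _⊕_; _:*_ to _⊗_; _:=_ to _⊜_)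

/-≤ : ∀ {i j} m → i ℤ.≤ j → i ℚ./ suc m ℚ.≤ j ℚ./ suc m
/-≤ {i} {j} m i≤j = ℚₚ.toℚᵘ-cancel-≤
  (ℚᵘₚ.≤-respʳ-≃ (ℚᵘₚ.≃-sym (ℚₚ.toℚᵘ-fromℚᵘ (mkℚᵘ j m)))
    (ℚᵘₚ.≤-respˡ-≃ (ℚᵘₚ.≃-sym (ℚₚ.toℚᵘ-fromℚᵘ (mkℚᵘ i m)))
      (*≤* (ℤₚ.*-monoʳ-≤-nonNeg (+ suc m) i≤j))))

/1-cancel-< : ∀ {i j} → i ℚ./ 1 ℚ.< j ℚ./ 1 → i ℤ.< j
/1-cancel-< {i} {j} h with ℚᵘₚ.<-respʳ-≃ (ℚₚ.toℚᵘ-fromℚᵘ (mkℚᵘ j 0))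
  (ℚᵘₚ.<-respˡ-≃ (ℚₚ.toℚᵘ-fromℚᵘ (mkℚᵘ i 0)) (ℚₚ.toℚᵘ-mono-< h))
... | *<* i1<j1 = subst₂ ℤ._<_ (ℤₚ.*-identityʳ i) (ℤₚ.*-identityʳ j) i1<j1

floor : ∀ q → ∃ λ z → z ℚ./ 1 ℚ.≤ q × q ℚ.< (z ℤ.+ 1ℤ) ℚ./ 1
floor q@(mkℚ n d-1 _) = z ,
  ℚₚ.toℚᵘ-cancel-≤ (ℚᵘₚ.≤-respˡ-≃ (ℚᵘₚ.≃-sym (ℚₚ.toℚᵘ-fromℚᵘ (mkℚᵘ z 0)))
    (*≤* (subst (z ℤ.* + suc d-1 ℤ.≤_) (sym (ℤₚ.*-identityʳ n)) (ℤd.[n/ℕd]*d≤n n (suc d-1))))) ,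
  ℚₚ.toℚᵘ-cancel-< (ℚᵘₚ.<-respʳ-≃ (ℚᵘₚ.≃-sym (ℚₚ.toℚᵘ-fromℚᵘ (mkℚᵘ (z ℤ.+ 1ℤ) 0)))
    (*<* (subst₂ (λ a b → a ℤ.< b ℤ.* + suc d-1) (sym (ℤₚ.*-identityʳ n)) (ℤₚ.+-comm 1ℤ z)
      (ℤd.n<s[n/ℕd]*d n (suc d-1)))))
  where
  z : ℤ
  z = n ℤd./ℕ suc d-1

nearest : ∀ q → ∃ λ z → q ℚ.≤ z ℚ./ 1 ℚ.+ ½ × z ℚ./ 1 ℚ.≤ q ℚ.+ ½
nearest q with floor q
... | z , z≤q , q<z+1 with q ℚₚ.≤? z ℚ./ 1 ℚ.+ ½
... | yes q≤ = z , q≤ , ℚₚ.≤-trans z≤q (ℚₚ.<⇒≤ (p<p+ε q (ℚₚ.positive⁻¹ ½)))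
... | no q≰ = z ℤ.+ 1ℤ ,
  ℚₚ.≤-trans (ℚₚ.<⇒≤ q<z+1) (ℚₚ.<⇒≤ (p<p+ε _ (ℚₚ.positive⁻¹ ½))) ,
  subst (ℚ._≤ q ℚ.+ ½) (/-+ z 1ℤ 0)
    (lin-≤ _ _ (ℚₚ.<⇒≤ (ℚₚ.≰⇒> q≰))
      (solve 2 (λ z q → (z :+ con 1ℚ) :+ q := (q :+ con ½) :+ (z :+ con ½)) refl (z ℚ./ 1) q))

/1-<-suc : ∀ i j → i ℚ./ 1 ℚ.< j ℚ./ 1 ℚ.+ 1ℚ → i ℤ.≤ j
/1-<-suc i j h = subst (i ℤ.≤_) (trans (cong ℤ.pred (ℤₚ.+-comm j 1ℤ)) (ℤₚ.pred-suc j))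
  (ℤₚ.i<j⇒i≤pred[j] (/1-cancel-< {i} {j ℤ.+ 1ℤ} (subst (i ℚ./ 1 ℚ.<_) (/-+ j 1ℤ 0) h)))

≤∧>⇒⊥ : ∀ {x y} → y ≤ᵣ x → ¬ (x <ᵣ y)
≤∧>⇒⊥ {x} {y} y≤x (mk< (γ , 0<γ , x<y)) =
  let N , f = eventually₂ {λ n → seq y n ℚ.< seq x n ℚ.+ γ} {λ n → seq x n ℚ.+ γ ℚ.< seq y n} {λ n → ⊥}
                (λ p q → ℚₚ.<-asym p q) (below y≤x γ 0<γ) x<y
  in f N ℕₚ.≤-refl

≈-stable : ∀ {x y} → ¬ ¬ (x ≈ᵣ y) → x ≈ᵣ y
≈-stable h = ≤ᵣ-antisym
  (≮⇒≥ λ y<x → h λ x≈y → ≤∧>⇒⊥ (≈⇒≤ x≈y) y<x)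
  (≮⇒≥ λ x<y → h λ x≈y → ≤∧>⇒⊥ (≈⇒≥ x≈y) x<y)

-- An integer equal to x must be the integer nearest to any rational within ½ of x.
IsInteger-stable : ∀ {x} → ¬ ¬ IsInteger x → IsInteger x
IsInteger-stable {x} ¬¬int with cauchy x (½ ℚ.* ½) (ℚₚ.positive⁻¹ (½ ℚ.* ½))
... | N , near with nearest (seq x N)
... | z , q≤ , ≤q = z , ≈-stable λ x≉z → ¬¬int λ (z′ , x≈z′) →
  let M , closeTo = close x≈z′ (½ ℚ.* ½) (ℚₚ.positive⁻¹ (½ ℚ.* ½))
      n   = M ⊔ N
      q   = seq x N
      s   = seq x n
      a   = near n N (ℕₚ.m≤n⊔m M N) ℕₚ.≤-refl
      b   = closeTo n (ℕₚ.m≤m⊔n M N)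
      q<  = lin-< q (z′ ℚ./ 1 ℚ.+ ½)
              (ℚₚ.+-mono-< (∣p-q∣<ε⇒q<p+ε s q a) (∣p-q∣<ε⇒p<q+ε s (z′ ℚ./ 1) b))
              (quarters q s (z′ ℚ./ 1))
      <q  = lin-< (z′ ℚ./ 1) (q ℚ.+ ½)
              (ℚₚ.+-mono-< (∣p-q∣<ε⇒p<q+ε s q a) (∣p-q∣<ε⇒q<p+ε s (z′ ℚ./ 1) b))
              (quarters′ q s (z′ ℚ./ 1))
  in x≉z (subst (λ w → x ≈ᵣ fromℤ w)
       (ℤₚ.≤-antisym
         (/1-<-suc z′ z (lin-< _ _ (ℚₚ.+-mono-<-≤ <q q≤) (eq (z′ ℚ./ 1) (z ℚ./ 1) q)))
         (/1-<-suc z z′ (lin-< _ _ (ℚₚ.+-mono-≤-< ≤q q<) (eq (z ℚ./ 1) (z′ ℚ./ 1) q)))) x≈z′)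
  where
  quarters : ∀ q s z → q ℚ.+ ((s ℚ.+ ½ ℚ.* ½) ℚ.+ (z ℚ.+ ½ ℚ.* ½)) ≡ (z ℚ.+ ½) ℚ.+ (q ℚ.+ s)
  quarters = solve 3 (λ q s z → q :+ ((s :+ con (½ ℚ.* ½)) :+ (z :+ con (½ ℚ.* ½))) :=
    (z :+ con ½) :+ (q :+ s)) refl
  quarters′ : ∀ q s z → z ℚ.+ ((q ℚ.+ ½ ℚ.* ½) ℚ.+ (s ℚ.+ ½ ℚ.* ½)) ≡ (q ℚ.+ ½) ℚ.+ (s ℚ.+ z)
  quarters′ = solve 3 (λ q s z → z :+ ((q :+ con (½ ℚ.* ½)) :+ (s :+ con (½ ℚ.* ½))) :=
    (q :+ con ½) :+ (s :+ z)) refl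
  eq : ∀ i j q → i ℚ.+ ((q ℚ.+ ½) ℚ.+ (j ℚ.+ ½)) ≡ (j ℚ.+ 1ℚ) ℚ.+ (i ℚ.+ q)
  eq = solve 3 (λ i j q → i :+ ((q :+ con ½) :+ (j :+ con ½)) := (j :+ con 1ℚ) :+ (i :+ q)) refl

IsInteger-resp-≈ : ∀ {x y} → x ≈ᵣ y → IsInteger x → IsInteger y
IsInteger-resp-≈ x≈y (z , x≈z) = z , ≈-trans (≈-sym x≈y) x≈z

IsInteger-+ : ∀ {x y} → IsInteger x → IsInteger y → IsInteger (x +ᵣ y)
IsInteger-+ (z , x≈z) (w , y≈w) = z ℤ.+ w ,
  ≈-trans (+-cong x≈z y≈w) (≈-pointwise λ _ → /-+ z w 0)

/1-minus : ∀ i j → i ℚ./ 1 ℚ.- j ℚ./ 1 ≡ (i ℤ.- j) ℚ./ 1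
/1-minus i j = trans (cong (ℚ._- j ℚ./ 1) (sym (trans (/-+ (i ℤ.- j) j 0) (cong (ℚ._/ 1) [i-j]+j≡i))))
  (solve 2 (λ a b → (a :+ b) :- b := a) refl ((i ℤ.- j) ℚ./ 1) (j ℚ./ 1))
  where
  [i-j]+j≡i : (i ℤ.- j) ℤ.+ j ≡ i
  [i-j]+j≡i = trans (ℤₚ.+-assoc i (ℤ.- j) j)
    (trans (cong (λ z → i ℤ.+ z) (ℤₚ.+-inverseˡ j)) (ℤₚ.+-identityʳ i))

fromℤ-minus : ∀ i j → fromℤ i -ᵣ fromℤ j ≈ᵣ fromℤ (i ℤ.- j)
fromℤ-minus i j = ≈-pointwise λ _ → /1-minus i j

IsInteger-minus : ∀ {x y} → IsInteger x → IsInteger y → IsInteger (x -ᵣ y)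
IsInteger-minus (z , x≈z) (w , y≈w) = z ℤ.- w , ≈-trans (sub-cong x≈z y≈w) (fromℤ-minus z w)

-- Small perturbations and rigidity of vertices

sumℚ : ∀ {n} → Vector ℚ n → ℚ
sumℚ = foldr ℚ._+_ 0ℚ

-- The bound is on the absolute value, so that one radius covers `ε` and `- ε`.
Near0 : (ℚ → Set) → Set
Near0 P = ∃ λ ε → 0ℚ ℚ.< ε × (∀ e → ℚ.∣ e ∣ ℚ.≤ ε → P e)

near-× : ∀ {P Q} → Near0 P → Near0 Q → Near0 (λ e → P e × Q e)
near-× (ε , 0<ε , p) (δ , 0<δ , q) with ℚₚ.≤-total ε δ
... | inj₁ ε≤δ = ε , 0<ε , λ e e≤ → p e e≤ , q e (ℚₚ.≤-trans e≤ ε≤δ)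
... | inj₂ δ≤ε = δ , 0<δ , λ e e≤ → p e (ℚₚ.≤-trans e≤ δ≤ε) , q e e≤

near-map : ∀ {P Q} → (∀ e → P e → Q e) → Near0 P → Near0 Q
near-map f (ε , 0<ε , p) = ε , 0<ε , λ e e≤ → f e (p e e≤)

-- Double negation passes through finite conjunctions one index at a time, and `near-×` keeps the
-- smaller radius.
near-Fin : ∀ {n} {P : Fin n → ℚ → Set} → (∀ i → ¬ ¬ Near0 (P i)) →
  ¬ ¬ Near0 (λ e → ∀ i → P i e)
near-Fin {zero} h k = k (1ℚ , ℚₚ.positive⁻¹ 1ℚ , λ _ _ ())
near-Fin {suc n} h k = h zero λ p₀ → near-Fin (λ i → h (suc i)) λ p →
  k (near-map (λ { e (q₀ , q) zero → q₀ ; e (q₀ , q) (suc i) → q i }) (near-× p₀ p))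

near-< : ∀ n {P : ∀ j → .(j < n) → ℚ → Set} → (∀ j .(h : j < n) → ¬ ¬ Near0 (P j h)) →
  ¬ ¬ Near0 (λ e → ∀ j .(h : j < n) → P j h e)
near-< zero h k = k (1ℚ , ℚₚ.positive⁻¹ 1ℚ , λ _ _ _ ())
near-< (suc n) {P} h k = h zero z<s λ p₀ →
  near-< n {λ j j<n → P (suc j) (s<s j<n)} (λ j j<n → h (suc j) (s<s j<n)) λ p →
  k (near-map (λ { e (q₀ , q) zero _ → q₀ ; e (q₀ , q) (suc j) j<n → q j (ℕ.s<s⁻¹ j<n) }) (near-× p₀ p))

≤∧≉⇒< : ∀ {x y} → x ≤ᵣ y → ¬ (x ≈ᵣ y) → ¬ ¬ (x <ᵣ y)
≤∧≉⇒< x≤y x≉y x≮y = x≉y (≤ᵣ-antisym x≤y (≮⇒≥ x≮y))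

shift : ∀ {n} → ℚ → (∀ j → Vector ℚ j) → X n → X n
shift e d x j h i = x j h i +ᵣ fromℚ (e ℚ.* d j i)

-- If `a ≡ b`, both sides move together. Otherwise the inequality is not tight, hence strict up to
-- double negation, and its gap `γ` absorbs every `e` of absolute value at most
-- `γ / (∣ a - b ∣ + 1)`.
near-≤ : ∀ {x y} a b → x ≤ᵣ y → (x ≈ᵣ y → a ≡ b) →
  ¬ ¬ Near0 (λ e → x +ᵣ fromℚ (e ℚ.* a) ≤ᵣ y +ᵣ fromℚ (e ℚ.* b))
near-≤ {x} {y} a b x≤y tight k with a ℚₚ.≟ b
... | yes refl = k (1ℚ , ℚₚ.positive⁻¹ 1ℚ , λ _ _ → +-mono-≤ᵣ x≤y (≈⇒≤ ≈-refl))
... | no a≢b = ≤∧≉⇒< x≤y (λ x≈y → a≢b (tight x≈y)) λ { (mk< (γ , 0<γ , x<y)) →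
  let B = ℚ.∣ a ℚ.- b ∣ ℚ.+ 1ℚ
      B>0 = ℚₚ.nonNeg+pos⇒pos ℚ.∣ a ℚ.- b ∣ {{ℚₚ.∣-∣-nonNeg (a ℚ.- b)}} 1ℚ
      δ , 0<δ , Bδ≡γ = divide B γ B>0 0<γ
  in k (δ , 0<δ , λ e ∣e∣≤δ → mk≤ λ ε 0<ε → eventually₁ {λ n → seq x n ℚ.+ γ ℚ.< seq y n}
      (λ {n} x+γ<y → ℚₚ.<-trans
        (lin-< (seq x n ℚ.+ e ℚ.* a) (seq y n ℚ.+ e ℚ.* b)
          (ℚₚ.+-mono-<-≤ x+γ<y (bound e δ γ ∣e∣≤δ Bδ≡γ (ℚ.positive 0<δ)))
          (solve 6 (λ x y a b e γ → (x :+ e :* a) :+ (y :+ γ) :=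
             (y :+ e :* b) :+ ((x :+ γ) :+ e :* (a :- b))) refl
            (seq x n) (seq y n) a b e γ))
        (p<p+ε (seq y n ℚ.+ e ℚ.* b) 0<ε)) x<y) }
  where
  bound : ∀ e δ γ → ℚ.∣ e ∣ ℚ.≤ δ → (ℚ.∣ a ℚ.- b ∣ ℚ.+ 1ℚ) ℚ.* δ ≡ γ → ℚ.Positive δ →
    e ℚ.* (a ℚ.- b) ℚ.≤ γ
  bound e δ γ ∣e∣≤δ eq δ>0 = begin
    e ℚ.* (a ℚ.- b)
      ≤⟨ p≤∣p∣ _ ⟩
    ℚ.∣ e ℚ.* (a ℚ.- b) ∣
      ≡⟨ ℚₚ.∣p*q∣≡∣p∣*∣q∣ e (a ℚ.- b) ⟩
    ℚ.∣ e ∣ ℚ.* ℚ.∣ a ℚ.- b ∣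
      ≤⟨ ℚₚ.*-monoʳ-≤-nonNeg ℚ.∣ a ℚ.- b ∣ {{ℚₚ.∣-∣-nonNeg (a ℚ.- b)}} ∣e∣≤δ ⟩
    δ ℚ.* ℚ.∣ a ℚ.- b ∣
      ≡⟨ ℚₚ.*-comm δ _ ⟩
    ℚ.∣ a ℚ.- b ∣ ℚ.* δ
      ≤⟨ ℚₚ.*-monoʳ-≤-nonNeg δ {{ℚₚ.pos⇒nonNeg δ {{δ>0}}}}
           (ℚₚ.<⇒≤ (p<p+ε ℚ.∣ a ℚ.- b ∣ (ℚₚ.positive⁻¹ 1ℚ))) ⟩
    (ℚ.∣ a ℚ.- b ∣ ℚ.+ 1ℚ) ℚ.* δ
      ≡⟨ eq ⟩
    γ ∎
    where open ℚₚ.≤-Reasoning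

sum-shift : ∀ {m} (v : Vector ℝ m) (c : Vector ℚ m) e → sumℚ c ≡ 0ℚ →
  sum (λ i → v i +ᵣ fromℚ (e ℚ.* c i)) ≈ᵣ sum v
sum-shift v c e c≡0 = ≈-pointwise λ n → trans (split v c n)
  (trans (cong (λ s → seq (sum v) n ℚ.+ e ℚ.* s) c≡0)
    (solve 2 (λ a e → a :+ e :* con 0ℚ := a) refl (seq (sum v) n) e))
  where
  split : ∀ {m} (v : Vector ℝ m) (c : Vector ℚ m) n →
    seq (sum (λ i → v i +ᵣ fromℚ (e ℚ.* c i))) n ≡ seq (sum v) n ℚ.+ e ℚ.* sumℚ c
  split {zero} v c n = solve 1 (λ e → con 0ℚ := con 0ℚ :+ e :* con 0ℚ) refl e
  split {suc m} v c n = trans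
    (cong (seq (v zero) n ℚ.+ e ℚ.* c zero ℚ.+_) (split (λ i → v (suc i)) (λ i → c (suc i)) n))
    (solve 5 (λ a b c d e → (a :+ e :* b) :+ (c :+ e :* d) := (a :+ c) :+ e :* (b :+ d)) refl
      (seq (v zero) n) (c zero) (seq (sum (λ i → v (suc i))) n) (sumℚ (λ i → c (suc i))) e)

fromℚ-injective : ∀ {p q} → fromℚ p ≈ᵣ fromℚ q → p ≡ q
fromℚ-injective {p} {q} p≈q with ℚₚ.<-cmp p q
... | tri≈ _ p≡q _ = p≡q
... | tri< p<q _ _ = contradiction (close p≈q (q ℚ.- p) (lin-< _ _ p<q
        (solve 2 (λ p q → con 0ℚ :+ q := (q :- p) :+ p) refl p q))) λ (N , h) →
      ℚₚ.<-irrefl refl (lin-< q q (∣p-q∣<ε⇒q<p+ε p q (h N ℕₚ.≤-refl))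
        (solve 2 (λ p q → q :+ (p :+ (q :- p)) := q :+ q) refl p q))
... | tri> _ _ q<p = contradiction (close p≈q (p ℚ.- q) (lin-< _ _ q<p
        (solve 2 (λ p q → con 0ℚ :+ p := (p :- q) :+ q) refl p q))) λ (N , h) →
      ℚₚ.<-irrefl refl (lin-< p p (∣p-q∣<ε⇒p<q+ε p q (h N ℕₚ.≤-refl))
        (solve 2 (λ p q → p :+ (q :+ (p :- q)) := p :+ p) refl p q))

0+0*p≡0 : ∀ e → 0ℤ ℚ./ 1 ≡ 0ℚ ℚ.+ e ℚ.* 0ℚ
0+0*p≡0 e = solve 1 (λ e → con 0ℚ := con 0ℚ :+ e :* con 0ℚ) refl e

-- The rational directions of the smallest face containing `x`; zero row sums preserve the weights.
-- `d` has all rows, without a bound, so that it can be defined by matching on the row number.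
record Direction {n} (x : X n) : Set where
  field
    d        : ∀ j → Vector ℚ j
    balanced : ∀ j → .(j ≤ n) → sumℚ (d j) ≡ 0ℚ
    fixTop   : ∀ i → d n i ≡ 0ℚ
    nonneg   : ∀ j .(h : j ≤ n) i → 0ᵣ ≈ᵣ x j h i → 0ℚ ≡ d j i
    upper    : ∀ j .(h : suc j ≤ n) (i : Fin j) →
               x j (ℕₚ.<⇒≤ h) i ≈ᵣ x (suc j) h (inject₁ i) → d j i ≡ d (suc j) (inject₁ i)
    lower    : ∀ j .(h : suc j ≤ n) (i : Fin j) →
               x (suc j) h (suc i) ≈ᵣ x j (ℕₚ.<⇒≤ h) i → d (suc j) (suc i) ≡ d j i

near-GT : ∀ {n λs μs} {x : X n} → GT λs μs x → (D : Direction x) →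
  ¬ ¬ Near0 (λ e → GT λs μs (shift e (Direction.d D) x))
near-GT {n} {λs} {μs} {x} gx D k =
  -- Nonnegativity concerns row `n` too, hence the range `suc n`. It is treated as an inequality
  -- whose left side 0 moves by `e * 0ℚ`, a term that `build` removes.
  near-< (suc n) (λ j h → near-Fin λ i →
    near-≤ 0ℚ (d j i) (P.nonneg j (ℕₚ.≤-pred h) i) (nonneg j (ℕₚ.≤-pred h) i)) λ N₁ →
  near-< n (λ j h → near-Fin λ i → near-≤ (d j i) _ (P.upper j h i) (upper j h i)) λ N₂ →
  near-< n (λ j h → near-Fin λ i → near-≤ _ (d j i) (P.lower j h i) (lower j h i)) λ N₃ →
  k (near-map build (near-× N₁ (near-× N₂ N₃)))
  where
  open Direction D
  module P = IsGTPattern (GT.isPattern gx)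
  build : ∀ e → _ → GT λs μs (shift e d x)
  build e (p₁ , p₂ , p₃) = record
    { isPattern = record
      { nonneg = λ j h i → ≤ᵣ-trans (≈⇒≤ (≈-pointwise λ _ → 0+0*p≡0 e)) (p₁ j (s≤s h) i)
      ; upper = p₂
      ; lower = p₃ }
    ; top = λ i → ≈-trans (≈-pointwise λ m → trans
        (cong (λ c → seq (x n ℕₚ.≤-refl i) m ℚ.+ e ℚ.* c) (fixTop i))
        (solve 2 (λ a e → a :+ e :* con 0ℚ := a) refl (seq (x n ℕₚ.≤-refl i) m) e)) (GT.top gx i)
    ; weight = λ j → ≈-trans (sub-cong
        (sum-shift (x (suc (toℕ j)) _) (d (suc (toℕ j))) e (balanced (suc (toℕ j)) (toℕ<n j)))
        (sum-shift (x (toℕ j) _) (d (toℕ j)) e (balanced (toℕ j) (ℕₚ.<⇒≤ (toℕ<n j)))))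
        (GT.weight gx j) }

-- `x` is the midpoint of `x - ε d` and `x + ε d`, so extremality gives `- ε d = ε d`. Equality of
-- rationals is decidable, so it suffices to refute `d ≢ 0`, which discharges the double negation of
-- `near-GT`.
vertex-rigid : ∀ {n λs μs} {x : X n} → IsVertex (GT λs μs) x → (D : Direction x) →
  ∀ j → .(j ≤ n) → ∀ i → Direction.d D j i ≡ 0ℚ
vertex-rigid {x = x} (gx , extreme) D j h i with Direction.d D j i ℚₚ.≟ 0ℚ
... | yes eq = eq
... | no d≢0 = ⊥-elim (near-GT gx D λ (ε , 0<ε , inGT) →
  let y≋z = extreme (shift (ℚ.- ε) d x) (shift ε d x)
        (inGT (ℚ.- ε) (ℚₚ.≤-reflexive (trans (ℚₚ.∣-p∣≡∣p∣ ε) (ℚₚ.0≤p⇒∣p∣≡p (ℚₚ.<⇒≤ 0<ε)))))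
        (inGT ε (ℚₚ.≤-reflexive (ℚₚ.0≤p⇒∣p∣≡p (ℚₚ.<⇒≤ 0<ε))))
        (fromℚ ½)
        (mk< (½ ℚ.* ½ , ℚₚ.positive⁻¹ (½ ℚ.* ½) , always λ _ →
          lin-< (0ℚ ℚ.+ ½ ℚ.* ½) ½ (ℚₚ.positive⁻¹ (½ ℚ.* ½)) refl))
        (mk< (½ ℚ.* ½ , ℚₚ.positive⁻¹ (½ ℚ.* ½) , always λ _ →
          lin-< (½ ℚ.+ ½ ℚ.* ½) 1ℚ (ℚₚ.positive⁻¹ (½ ℚ.* ½)) refl))
        (λ j h i → ≈-pointwise λ m →
          solve 3 (λ x ε d → x := (con 1ℚ :- con ½) :* (x :+ (:- ε) :* d) :+ con ½ :* (x :+ ε :* d)) refl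
            (seq (x j h i) m) ε (d j i))
  in d≢0 (zero-product ε (d j i) 0<ε (fromℚ-injective (+-cancelˡ ≈-refl (y≋z j h i)))))
  where
  d = Direction.d D
  zero-product : ∀ ε d → 0ℚ ℚ.< ε → (ℚ.- ε) ℚ.* d ≡ ε ℚ.* d → d ≡ 0ℚ
  zero-product ε d 0<ε eq = ℚₚ.≤-antisym
    (ℚₚ.*-cancelˡ-≤-pos ε {{ℚ.positive 0<ε}} (ℚₚ.≤-reflexive εd≡ε0))
    (ℚₚ.*-cancelˡ-≤-pos ε {{ℚ.positive 0<ε}} (ℚₚ.≤-reflexive (sym εd≡ε0)))
    where
    εd≡ε0 : ε ℚ.* d ≡ ε ℚ.* 0ℚ
    εd≡ε0 = trans (sym (solve 2 (λ ε d → con ½ :* (ε :* d :- (:- ε) :* d) := ε :* d) refl ε d))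
      (trans (cong (λ a → ½ ℚ.* (ε ℚ.* d ℚ.- a)) eq)
        (solve 2 (λ ε d → con ½ :* (ε :* d :- ε :* d) := ε :* con 0ℚ) refl ε d))

-- Integrality of vertices for `n` at most 4

weight-at : ∀ {n λs μs} {x : X n} → GT λs μs x → ∀ j .(h : j < n) →
  sum (x (suc j) h) -ᵣ sum (x j (ℕₚ.<⇒≤ h)) ≈ᵣ fromℤ (μs (fromℕ< h))
weight-at {n} {λs} {μs} {x} gx j h = at (fromℕ< h) (toℕ-fromℕ< h) h
  where
  at : ∀ (k : Fin n) {j} → toℕ k ≡ j → .(h : j < n) →
    sum (x (suc j) h) -ᵣ sum (x j (ℕₚ.<⇒≤ h)) ≈ᵣ fromℤ (μs k)
  at k refl _ = GT.weight gx k

IsInteger-fromℤ : ∀ z → IsInteger (fromℤ z)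
IsInteger-fromℤ z = z , ≈-refl

IsInteger-cancelʳ : ∀ {x y} → IsInteger (x +ᵣ y) → IsInteger y → IsInteger x
IsInteger-cancelʳ {x} {y} x+y-int y-int =
  IsInteger-resp-≈ ([x+y]-y≈x x y) (IsInteger-minus x+y-int y-int)

IsInteger-cancelˡ : ∀ {x y} → IsInteger (x +ᵣ y) → IsInteger x → IsInteger y
IsInteger-cancelˡ {x} {y} x+y-int x-int =
  IsInteger-resp-≈ ([x+y]-x≈y x y) (IsInteger-minus x+y-int x-int)

row-sum-IsInteger : ∀ {n λs μs} {x : X n} → GT λs μs x → ∀ j .(h : j ≤ n) → IsInteger (sum (x j h))
row-sum-IsInteger gx zero h = IsInteger-fromℤ 0ℤ
row-sum-IsInteger {μs = μs} {x} gx (suc j) h =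
  IsInteger-resp-≈ (x+[y-x]≈y (sum (x j (ℕₚ.<⇒≤ h))) (sum (x (suc j) h)))
    (IsInteger-+ (row-sum-IsInteger gx j (ℕₚ.<⇒≤ h)) (μs (fromℕ< h) , weight-at gx j h))

-- Meant for equal neighbours `u` and `v` of one row: interlacing puts between them an entry `w` of
-- an adjacent row that is known to be an integer.
IsInteger-squeeze : ∀ {u v w} → u ≈ᵣ v → v ≤ᵣ w → w ≤ᵣ u → IsInteger w → IsInteger u
IsInteger-squeeze u≈v v≤w w≤u = IsInteger-resp-≈ (≤ᵣ-antisym w≤u (≤ᵣ-trans (≈⇒≤ u≈v) v≤w))

sumℚ-zero : ∀ n → sumℚ {n} (λ _ → 0ℚ) ≡ 0ℚ
sumℚ-zero zero = refl
sumℚ-zero (suc n) = trans (ℚₚ.+-identityˡ _) (sumℚ-zero n)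

1≢0 : 1ℚ ≢ 0ℚ
1≢0 ()

-1ℚ : ℚ
-1ℚ = ℚ.- 1ℚ

module BottomRows {n λs μs} {x : X n} (gx : GT λs μs x) where
  open IsGTPattern (GT.isPattern gx)

  top-int : ∀ i → IsInteger (x n ℕₚ.≤-refl i)
  top-int i = λs i , GT.top gx i

  x₁₁-int : ∀ .(h : 1 ≤ n) → IsInteger (x 1 h zero)
  x₁₁-int h = IsInteger-cancelʳ (row-sum-IsInteger gx 1 h) (IsInteger-fromℤ 0ℤ)

  x₁₂-int⇒x₂₂-int : ∀ .(h : 2 ≤ n) → IsInteger (x 2 h zero) → IsInteger (x 2 h (suc zero))
  x₁₂-int⇒x₂₂-int h p =
    IsInteger-cancelʳ (IsInteger-cancelˡ (row-sum-IsInteger gx 2 h) p) (IsInteger-fromℤ 0ℤ)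

  x₂₂-int⇒x₁₂-int : ∀ .(h : 2 ≤ n) → IsInteger (x 2 h (suc zero)) → IsInteger (x 2 h zero)
  x₂₂-int⇒x₁₂-int h q = IsInteger-cancelʳ (row-sum-IsInteger gx 2 h) (IsInteger-+ q (IsInteger-fromℤ 0ℤ))

  x₂₂≈x₁₂⇒int : ∀ .(h : 2 ≤ n) → x 2 h (suc zero) ≈ᵣ x 2 h zero → IsInteger (x 2 h zero)
  x₂₂≈x₁₂⇒int h eq = IsInteger-squeeze (≈-sym eq) (lower 1 h zero) (upper 1 h zero) (x₁₁-int (ℕₚ.<⇒≤ h))

module FourRows {λs μs} {x : X 4} (vx : IsVertex (GT λs μs) x) where
  gx = proj₁ vx
  open IsGTPattern (GT.isPattern gx)
  open BottomRows gx

  4≤4 = ℕₚ.≤-refl {4}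
  3≤4 = ℕₚ.n≤1+n 3
  2≤4 : 2 ≤ 4
  2≤4 = s≤s (s≤s z≤n)
  -- Rows 1 and 4 are integral from the outset. The other two interlace as `a ≥ p ≥ b ≥ q ≥ c`.
  a b c p q : ℝ
  a = x 3 3≤4 zero
  b = x 3 3≤4 (suc zero)
  c = x 3 3≤4 (suc (suc zero))
  p = x 2 2≤4 zero
  q = x 2 2≤4 (suc zero)

  sum₃ = row-sum-IsInteger gx 3 3≤4

  a,b⇒c : IsInteger a → IsInteger b → IsInteger c
  a,b⇒c ia ib = IsInteger-cancelʳ (IsInteger-cancelˡ (IsInteger-cancelˡ sum₃ ia) ib) (IsInteger-fromℤ 0ℤ)

  a,c⇒b : IsInteger a → IsInteger c → IsInteger b
  a,c⇒b ia ic = IsInteger-cancelʳ (IsInteger-cancelˡ sum₃ ia) (IsInteger-+ ic (IsInteger-fromℤ 0ℤ))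

  b,c⇒a : IsInteger b → IsInteger c → IsInteger a
  b,c⇒a ib ic = IsInteger-cancelʳ sum₃ (IsInteger-+ ib (IsInteger-+ ic (IsInteger-fromℤ 0ℤ)))

  p⇒q = x₁₂-int⇒x₂₂-int 2≤4
  q⇒p = x₂₂-int⇒x₁₂-int 2≤4

  a≈b⇒int : a ≈ᵣ b → IsInteger a
  a≈b⇒int eq = IsInteger-squeeze eq (upper 3 4≤4 (suc zero)) (lower 3 4≤4 zero) (top-int (suc zero))

  b≈c⇒int : b ≈ᵣ c → IsInteger b
  b≈c⇒int eq =
    IsInteger-squeeze eq (upper 3 4≤4 (suc (suc zero))) (lower 3 4≤4 (suc zero))
      (top-int (suc (suc zero)))

  -- An entry tight against row 1, row 4 or 0 is an integer, so keeping integer entries fixed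
  -- settles those constraints; `p` and `q` are integral together, as their sum is an integer. What
  -- remains are the four possible equalities between rows 2 and 3.
  no-direction : ∀ δ α β γ → α ℚ.+ (β ℚ.+ (γ ℚ.+ 0ℚ)) ≡ 0ℚ →
    (IsInteger p → δ ≡ 0ℚ) → (IsInteger a → α ≡ 0ℚ) → (IsInteger b → β ≡ 0ℚ) → (IsInteger c → γ ≡ 0ℚ) →
    (p ≈ᵣ a → δ ≡ α) → (b ≈ᵣ p → β ≡ δ) → (q ≈ᵣ b → ℚ.- δ ≡ β) → (c ≈ᵣ q → γ ≡ ℚ.- δ) →
    δ ≡ 0ℚ × α ≡ 0ℚ × β ≡ 0ℚ × γ ≡ 0ℚ
  no-direction δ α β γ α+β+γ≡0 p-int a-int b-int c-int p≈a b≈p q≈b c≈q =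
    rigid 2 2≤4 zero , rigid 3 3≤4 zero , rigid 3 3≤4 (suc zero) , rigid 3 3≤4 (suc (suc zero))
    where
    d : ∀ j → Vector ℚ j
    d 2 zero = δ
    d 2 (suc zero) = ℚ.- δ
    d 3 zero = α
    d 3 (suc zero) = β
    d 3 (suc (suc zero)) = γ
    d _ _ = 0ℚ
    q-int : IsInteger q → ℚ.- δ ≡ 0ℚ
    q-int iq = cong (ℚ.-_) (p-int (q⇒p iq))
    D : Direction x
    D = record
      { d = d
      ; balanced = λ
        { 0 _ → refl
        ; 1 _ → refl
        ; 2 _ → solve 1 (λ δ → δ :+ (:- δ :+ con 0ℚ) := con 0ℚ) refl δ
        ; 3 _ → α+β+γ≡0
        ; (suc (suc (suc (suc j)))) _ → sumℚ-zero (4 + j) }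
      ; fixTop = λ _ → refl
      ; nonneg = λ
        { 1 _ zero _ → refl
        ; 2 _ zero z → sym (p-int (0ℤ , ≈-sym z))
        ; 2 _ (suc zero) z → sym (q-int (0ℤ , ≈-sym z))
        ; 3 _ zero z → sym (a-int (0ℤ , ≈-sym z))
        ; 3 _ (suc zero) z → sym (b-int (0ℤ , ≈-sym z))
        ; 3 _ (suc (suc zero)) z → sym (c-int (0ℤ , ≈-sym z))
        ; (suc (suc (suc (suc j)))) _ _ _ → refl }
      ; upper = λ
        { 1 _ zero e → sym (p-int (IsInteger-resp-≈ e (x₁₁-int _)))
        ; 2 _ zero e → p≈a e
        ; 2 _ (suc zero) e → q≈b e
        ; 3 _ zero e → a-int (IsInteger-resp-≈ (≈-sym e) (top-int _))
        ; 3 _ (suc zero) e → b-int (IsInteger-resp-≈ (≈-sym e) (top-int _))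
        ; 3 _ (suc (suc zero)) e → c-int (IsInteger-resp-≈ (≈-sym e) (top-int _))
        ; (suc (suc (suc (suc j)))) _ _ _ → refl }
      ; lower = λ
        { 1 _ zero e → q-int (IsInteger-resp-≈ (≈-sym e) (x₁₁-int _))
        ; 2 _ zero e → b≈p e
        ; 2 _ (suc zero) e → c≈q e
        ; 3 _ zero e → sym (a-int (IsInteger-resp-≈ e (top-int _)))
        ; 3 _ (suc zero) e → sym (b-int (IsInteger-resp-≈ e (top-int _)))
        ; 3 _ (suc (suc zero)) e → sym (c-int (IsInteger-resp-≈ e (top-int _)))
        ; (suc (suc (suc (suc j)))) _ _ _ → refl } }
    rigid = vertex-rigid vx D

  -- If `p` is not an integer, neither is `q`. Then `(1, -1)` in row 2 is completed by a move of row
  -- 3 with sum 0 that follows the equalities with row 2. Its sum being an integer, row 3 never has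
  -- exactly one non-integral entry, so there is a second one to compensate.
  p-int : ¬ ¬ IsInteger p
  p-int ¬ip = ¬¬a-int ¬a-int
    where
    ¬iq : ¬ IsInteger q
    ¬iq iq = ¬ip (q⇒p iq)
    move : ∀ α β γ → α ℚ.+ (β ℚ.+ (γ ℚ.+ 0ℚ)) ≡ 0ℚ →
      (IsInteger a → α ≡ 0ℚ) → (IsInteger b → β ≡ 0ℚ) → (IsInteger c → γ ≡ 0ℚ) →
      (p ≈ᵣ a → 1ℚ ≡ α) → (b ≈ᵣ p → β ≡ 1ℚ) → (q ≈ᵣ b → -1ℚ ≡ β) → (c ≈ᵣ q → γ ≡ -1ℚ) → ⊥
    move α β γ s ia ib ic p≈a b≈p q≈b c≈q = 1≢0
      (proj₁ (no-direction 1ℚ α β γ s (⊥-elim ∘ ¬ip) ia ib ic p≈a b≈p q≈b c≈q))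

    p≈a⇒ : p ≈ᵣ a → ¬ IsInteger a
    p≈a⇒ e ia = ¬ip (IsInteger-resp-≈ (≈-sym e) ia)
    c≈q⇒ : c ≈ᵣ q → ¬ IsInteger c
    c≈q⇒ e ic = ¬iq (IsInteger-resp-≈ e ic)
    b≈p⇒ : b ≈ᵣ p → ¬ IsInteger b
    b≈p⇒ e ib = ¬ip (IsInteger-resp-≈ e ib)
    q≈b⇒ : q ≈ᵣ b → ¬ IsInteger b
    q≈b⇒ e ib = ¬iq (IsInteger-resp-≈ (≈-sym e) ib)

    -- Here `b` has to move with `p`. A further equality `p ≈ᵣ a` or `q ≈ᵣ b` would squeeze an
    -- integer between equal neighbours. So -1 goes to `c` if that is non-integral, and to `a`
    -- otherwise.
    ¬b≈p : ¬ (b ≈ᵣ p)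
    ¬b≈p b≈p = ¬¬ic λ ic → move -1ℚ 1ℚ 0ℚ refl
        (λ ia → ⊥-elim (b≈p⇒ b≈p (a,c⇒b ia ic))) (⊥-elim ∘ b≈p⇒ b≈p) (λ _ → refl)
        (⊥-elim ∘ ¬p≈a) (λ _ → refl) (⊥-elim ∘ ¬q≈b) (λ e → ⊥-elim (c≈q⇒ e ic))
      where
      ¬p≈a : ¬ (p ≈ᵣ a)
      ¬p≈a p≈a = ¬ip (IsInteger-resp-≈ (≈-sym p≈a) (a≈b⇒int (≈-sym (≈-trans b≈p p≈a))))
      ¬q≈b : ¬ (q ≈ᵣ b)
      ¬q≈b q≈b = ¬ip (x₂₂≈x₁₂⇒int 2≤4 (≈-trans q≈b b≈p))
      ¬¬ic : ¬ ¬ IsInteger c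
      ¬¬ic ¬ic = move 0ℚ 1ℚ -1ℚ refl
        (λ _ → refl) (⊥-elim ∘ b≈p⇒ b≈p) (⊥-elim ∘ ¬ic)
        (⊥-elim ∘ ¬p≈a) (λ _ → refl) (⊥-elim ∘ ¬q≈b) (λ _ → refl)

    -- The mirror image: `b` moves with `q`, and 1 goes to `a` if that is non-integral, to `c`
    -- otherwise.
    ¬q≈b : ¬ (q ≈ᵣ b)
    ¬q≈b q≈b = ¬¬ia λ ia → move 0ℚ -1ℚ 1ℚ refl
        (λ _ → refl) (⊥-elim ∘ q≈b⇒ q≈b) (λ ic → ⊥-elim (q≈b⇒ q≈b (a,c⇒b ia ic)))
        (λ e → ⊥-elim (p≈a⇒ e ia)) (⊥-elim ∘ ¬b≈p) (λ _ → refl) (⊥-elim ∘ ¬c≈q)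
      where
      ¬c≈q : ¬ (c ≈ᵣ q)
      ¬c≈q c≈q = q≈b⇒ q≈b (b≈c⇒int (≈-sym (≈-trans c≈q q≈b)))
      ¬¬ia : ¬ ¬ IsInteger a
      ¬¬ia ¬ia = move 1ℚ -1ℚ 0ℚ refl
        (⊥-elim ∘ ¬ia) (⊥-elim ∘ q≈b⇒ q≈b) (λ _ → refl)
        (λ _ → refl) (⊥-elim ∘ ¬b≈p) (λ _ → refl) (⊥-elim ∘ ¬c≈q)

    -- Now `b` is tied to neither `p` nor `q`. A non-integral `a` takes 1, which also suits
    -- `p ≈ᵣ a`; -1 goes to `c` if that is non-integral, to `b` otherwise.
    ¬¬a-int : ¬ ¬ IsInteger a
    ¬¬a-int ¬ia = ¬¬ic λ ic → move 1ℚ -1ℚ 0ℚ refl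
        (⊥-elim ∘ ¬ia) (λ ib → ⊥-elim (¬ia (b,c⇒a ib ic))) (λ _ → refl)
        (λ _ → refl) (⊥-elim ∘ ¬b≈p) (λ _ → refl) (λ e → ⊥-elim (c≈q⇒ e ic))
      where
      ¬¬ic : ¬ ¬ IsInteger c
      ¬¬ic ¬ic = move 1ℚ 0ℚ -1ℚ refl
        (⊥-elim ∘ ¬ia) (λ _ → refl) (⊥-elim ∘ ¬ic)
        (λ _ → refl) (⊥-elim ∘ ¬b≈p) (⊥-elim ∘ ¬q≈b) (λ _ → refl)

    -- With `a` fixed, a non-integral `c` takes -1 and `b` balances it. If `c` is integral too, row
    -- 3 stays as it is and only row 2 moves.
    ¬a-int : ¬ IsInteger a
    ¬a-int ia = ¬¬ic λ ic → move 0ℚ 0ℚ 0ℚ refl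
        (λ _ → refl) (λ _ → refl) (λ _ → refl)
        (λ e → ⊥-elim (p≈a⇒ e ia)) (⊥-elim ∘ ¬b≈p) (⊥-elim ∘ ¬q≈b) (λ e → ⊥-elim (c≈q⇒ e ic))
      where
      ¬¬ic : ¬ ¬ IsInteger c
      ¬¬ic ¬ic = move 0ℚ 1ℚ -1ℚ refl
        (λ _ → refl) (λ ib → ⊥-elim (¬ic (a,b⇒c ia ib))) (⊥-elim ∘ ¬ic)
        (λ e → ⊥-elim (p≈a⇒ e ia)) (⊥-elim ∘ ¬b≈p) (⊥-elim ∘ ¬q≈b) (λ _ → refl)

  row₂-int : ¬ ¬ (IsInteger p × IsInteger q)
  row₂-int k = p-int λ ip → k (ip , p⇒q ip)

  module _ (ip : IsInteger p) (iq : IsInteger q) where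
    -- With row 2 integral, a non-integral entry of row 3 is tight against nothing. Two of them
    -- could move against each other, and a single one contradicts the integral row sum.
    move₃ : ∀ α β γ → α ℚ.+ (β ℚ.+ (γ ℚ.+ 0ℚ)) ≡ 0ℚ →
      (IsInteger a → α ≡ 0ℚ) → (IsInteger b → β ≡ 0ℚ) → (IsInteger c → γ ≡ 0ℚ) →
      α ≡ 0ℚ × β ≡ 0ℚ × γ ≡ 0ℚ
    move₃ α β γ s ia ib ic = proj₂ (no-direction 0ℚ α β γ s (λ _ → refl) ia ib ic
      (λ e → sym (ia (IsInteger-resp-≈ e ip))) (λ e → ib (IsInteger-resp-≈ (≈-sym e) ip))
      (λ e → sym (ib (IsInteger-resp-≈ e iq))) (λ e → ic (IsInteger-resp-≈ (≈-sym e) iq)))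

    a-or-b : ¬ IsInteger a → ¬ ¬ IsInteger b
    a-or-b ¬ia ¬ib = 1≢0 (proj₁ (move₃ 1ℚ -1ℚ 0ℚ refl (⊥-elim ∘ ¬ia) (⊥-elim ∘ ¬ib) (λ _ → refl)))

    a-or-c : ¬ IsInteger a → ¬ ¬ IsInteger c
    a-or-c ¬ia ¬ic = 1≢0 (proj₁ (move₃ 1ℚ 0ℚ -1ℚ refl (⊥-elim ∘ ¬ia) (λ _ → refl) (⊥-elim ∘ ¬ic)))

    b-or-c : ¬ IsInteger b → ¬ ¬ IsInteger c
    b-or-c ¬ib ¬ic =
      1≢0 (proj₁ (proj₂ (move₃ 0ℚ 1ℚ -1ℚ refl (λ _ → refl) (⊥-elim ∘ ¬ib) (⊥-elim ∘ ¬ic))))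

    a-int : ¬ ¬ IsInteger a
    a-int ¬ia = a-or-b ¬ia λ ib → a-or-c ¬ia λ ic → ¬ia (b,c⇒a ib ic)

    b-int : ¬ ¬ IsInteger b
    b-int ¬ib = a-int λ ia → b-or-c ¬ib λ ic → ¬ib (a,c⇒b ia ic)

    c-int : ¬ ¬ IsInteger c
    c-int ¬ic = a-int λ ia → b-int λ ib → ¬ic (a,b⇒c ia ib)

  row₃-int : ∀ i → ¬ ¬ IsInteger (x 3 3≤4 i)
  row₃-int zero k = row₂-int λ (ip , iq) → a-int ip iq k
  row₃-int (suc zero) k = row₂-int λ (ip , iq) → b-int ip iq k
  row₃-int (suc (suc zero)) k = row₂-int λ (ip , iq) → c-int ip iq k

  all-int : ∀ j .(h : j ≤ 4) i → ¬ ¬ IsInteger (x j h i)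
  all-int 1 h zero k = k (x₁₁-int h)
  all-int 2 h zero k = row₂-int λ (ip , iq) → k ip
  all-int 2 h (suc zero) k = row₂-int λ (ip , iq) → k iq
  all-int 3 h i = row₃-int i
  all-int 4 h i k = k (top-int i)
  all-int (suc (suc (suc (suc (suc j))))) h = ⊥-elim-irr (ℕₚ.<⇒≱ (s≤s (ℕₚ.m≤m+n 4 j)) h)

module ThreeRows {λs μs} {x : X 3} (vx : IsVertex (GT λs μs) x) where
  open IsGTPattern (GT.isPattern (proj₁ vx))
  open BottomRows (proj₁ vx)

  2≤3 : 2 ≤ 3
  2≤3 = ℕₚ.n≤1+n 2

  -- Rows 1 and 3 are integral, so a non-integral row 2 is tight against nothing and moves by
  -- `(1, -1)`.
  p-int : ¬ ¬ IsInteger (x 2 2≤3 zero)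
  p-int ¬ip = 1≢0 (vertex-rigid vx D 2 2≤3 zero)
    where
    ¬iq : ¬ IsInteger (x 2 2≤3 (suc zero))
    ¬iq iq = ¬ip (x₂₂-int⇒x₁₂-int 2≤3 iq)
    d : ∀ j → Vector ℚ j
    d 2 zero = 1ℚ
    d 2 (suc zero) = -1ℚ
    d _ _ = 0ℚ
    D : Direction x
    D = record
      { d = d
      ; balanced = λ
        { 0 _ → refl
        ; 1 _ → refl
        ; 2 _ → refl
        ; (suc (suc (suc j))) _ → sumℚ-zero (3 + j) }
      ; fixTop = λ _ → refl
      ; nonneg = λ
        { 1 _ zero _ → refl
        ; 2 _ zero e → contradiction (0ℤ , ≈-sym e) ¬ip
        ; 2 _ (suc zero) e → contradiction (0ℤ , ≈-sym e) ¬iq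
        ; (suc (suc (suc j))) _ _ _ → refl }
      ; upper = λ
        { 1 _ zero e → contradiction (IsInteger-resp-≈ e (x₁₁-int _)) ¬ip
        ; 2 _ zero e → contradiction (IsInteger-resp-≈ (≈-sym e) (top-int _)) ¬ip
        ; 2 _ (suc zero) e → contradiction (IsInteger-resp-≈ (≈-sym e) (top-int _)) ¬iq
        ; (suc (suc (suc j))) _ _ _ → refl }
      ; lower = λ
        { 1 _ zero e → contradiction (IsInteger-resp-≈ (≈-sym e) (x₁₁-int _)) ¬iq
        ; 2 _ zero e → contradiction (IsInteger-resp-≈ e (top-int _)) ¬ip
        ; 2 _ (suc zero) e → contradiction (IsInteger-resp-≈ e (top-int _)) ¬iq
        ; (suc (suc (suc j))) _ _ _ → refl } }

  all-int : ∀ j .(h : j ≤ 3) i → ¬ ¬ IsInteger (x j h i)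
  all-int 1 h zero k = k (x₁₁-int h)
  all-int 2 h zero = p-int
  all-int 2 h (suc zero) k = p-int λ ip → k (x₁₂-int⇒x₂₂-int 2≤3 ip)
  all-int 3 h i k = k (top-int i)
  all-int (suc (suc (suc (suc j)))) h = ⊥-elim-irr (ℕₚ.<⇒≱ (s≤s (ℕₚ.m≤m+n 3 j)) h)

vertex-IsInteger : ∀ n → 1 ≤ n → n ≤ 4 → ∀ (λs μs : Vector ℤ n) (x : X n) → IsVertex (GT λs μs) x →
  ∀ j .(h : j ≤ n) i → IsInteger (x j h i)
vertex-IsInteger 1 _ _ λs μs x vx 1 h i = BottomRows.top-int (proj₁ vx) i
vertex-IsInteger 1 _ _ λs μs x vx (suc (suc j)) h = ⊥-elim-irr (ℕₚ.<⇒≱ (s≤s (ℕₚ.m≤m+n 1 j)) h)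
vertex-IsInteger 2 _ _ λs μs x vx 1 h zero = BottomRows.x₁₁-int (proj₁ vx) h
vertex-IsInteger 2 _ _ λs μs x vx 2 h i = BottomRows.top-int (proj₁ vx) i
vertex-IsInteger 2 _ _ λs μs x vx (suc (suc (suc j))) h = ⊥-elim-irr (ℕₚ.<⇒≱ (s≤s (ℕₚ.m≤m+n 2 j)) h)
vertex-IsInteger 3 _ _ λs μs x vx j h i = IsInteger-stable (ThreeRows.all-int vx j h i)
vertex-IsInteger 4 _ _ λs μs x vx j h i = IsInteger-stable (FourRows.all-int vx j h i)
vertex-IsInteger (suc (suc (suc (suc (suc n))))) _ (s≤s (s≤s (s≤s (s≤s ()))))

-- Points determined by their tight constraints

<⇒≤ᵣ : ∀ {x y} → x <ᵣ y → x ≤ᵣ y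
<⇒≤ᵣ {x} {y} (mk< (γ , 0<γ , x<y)) = mk≤ λ ε 0<ε → eventually₁ {λ n → seq x n ℚ.+ γ ℚ.< seq y n}
  (λ {n} p → ℚₚ.<-trans (ℚₚ.<-trans (p<p+ε (seq x n) 0<γ) p) (p<p+ε (seq y n) 0<ε)) x<y

sum-mono-≤ : ∀ {n} {u v : Vector ℝ n} → (∀ i → u i ≤ᵣ v i) → sum u ≤ᵣ sum v
sum-mono-≤ {zero} h = ≈⇒≤ ≈-refl
sum-mono-≤ {suc n} h = +-mono-≤ᵣ (h zero) (sum-mono-≤ (λ i → h (suc i)))

sum-determines-≤ : ∀ {n} {u v : Vector ℝ n} p → sum v ≤ᵣ sum u →
  (∀ i → i ≢ p → u i ≤ᵣ v i) → v p ≤ᵣ u p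
sum-determines-≤ {suc n} {u} {v} zero s h =
  ≤ᵣ-trans (≈⇒≥ ([x+y]-y≈x _ (sum λ i → v (suc i))))
    (≤ᵣ-trans (+-mono-≤ᵣ s (-‿anti-≤ (sum-mono-≤ λ i → h (suc i) λ ())))
      (≈⇒≤ ([x+y]-y≈x _ (sum λ i → u (suc i)))))
sum-determines-≤ {suc n} {u} {v} (suc p) s h = sum-determines-≤ p
  (≤ᵣ-trans (≈⇒≥ ([x+y]-x≈y (v zero) _))
    (≤ᵣ-trans (+-mono-≤ᵣ s (-‿anti-≤ (h zero λ ()))) (≈⇒≤ ([x+y]-x≈y (u zero) _))))
  λ i i≢p → h (suc i) λ { refl → i≢p refl }

sum-determines : ∀ {n} {u v : Vector ℝ n} p → sum u ≈ᵣ sum v →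
  (∀ i → i ≢ p → u i ≈ᵣ v i) → u p ≈ᵣ v p
sum-determines p s h = ≤ᵣ-antisym
  (sum-determines-≤ p (≈⇒≤ s) λ i i≢p → ≈⇒≥ (h i i≢p))
  (sum-determines-≤ p (≈⇒≥ s) λ i i≢p → ≈⇒≤ (h i i≢p))

-- The error `½ * (η * ε)` enters twice: in the bound on `u′`, scaled by `t < 1`, and in the total.
-- Together this is less than `η * ε`, hence less than the excess `s * ε` that `u + ε ≤ v` would
-- cause.
weighted-< : ∀ s t u v u′ v′ η ε → 0ℚ ℚ.< η → 0ℚ ℚ.< ε → 0ℚ ℚ.+ η ℚ.< s → 0ℚ ℚ.< t → t ℚ.< 1ℚ →
  u′ ℚ.< v′ ℚ.+ ½ ℚ.* (η ℚ.* ε) →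
  s ℚ.* v ℚ.+ t ℚ.* v′ ℚ.< (s ℚ.* u ℚ.+ t ℚ.* u′) ℚ.+ ½ ℚ.* (η ℚ.* ε) →
  v ℚ.< u ℚ.+ ε
weighted-< s t u v u′ v′ η ε 0<η 0<ε η<s 0<t t<1 u′< total with v ℚₚ.<? u ℚ.+ ε
... | yes v< = v<
... | no v≮ = contradiction
  (ℚₚ.+-mono-<
    (ℚₚ.+-mono-<
      (ℚₚ.+-mono-≤-<
        (ℚₚ.*-monoˡ-≤-nonNeg s {{ℚₚ.pos⇒nonNeg s {{s>0}}}} (ℚₚ.≮⇒≥ v≮))
        (ℚₚ.*-monoˡ-<-pos ε {{ℚ.positive 0<ε}} η<s))
      (ℚₚ.*-monoʳ-<-pos t {{ℚ.positive 0<t}} u′<))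
    (ℚₚ.+-mono-<
      (ℚₚ.*-monoˡ-<-pos (½ ℚ.* (η ℚ.* ε)) {{ℚ.positive 0<κ}} t<1)
      total))
  (ℚₚ.<-irrefl eq)
  where
  s>0 : ℚ.Positive s
  s>0 = ℚ.positive (ℚₚ.<-trans 0<η (subst (ℚ._< s) (ℚₚ.+-identityˡ η) η<s))
  0<κ : 0ℚ ℚ.< ½ ℚ.* (η ℚ.* ε)
  0<κ = half-pos _ (ℚₚ.positive⁻¹ (η ℚ.* ε) {{ℚₚ.pos*pos⇒pos η {{ℚ.positive 0<η}} ε {{ℚ.positive 0<ε}}}})
  eq : ((s ℚ.* (u ℚ.+ ε) ℚ.+ (0ℚ ℚ.+ η) ℚ.* ε) ℚ.+ t ℚ.* u′) ℚ.+
       (t ℚ.* (½ ℚ.* (η ℚ.* ε)) ℚ.+ (s ℚ.* v ℚ.+ t ℚ.* v′)) ≡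
       ((s ℚ.* v ℚ.+ s ℚ.* ε) ℚ.+ t ℚ.* (v′ ℚ.+ ½ ℚ.* (η ℚ.* ε))) ℚ.+
       (1ℚ ℚ.* (½ ℚ.* (η ℚ.* ε)) ℚ.+ ((s ℚ.* u ℚ.+ t ℚ.* u′) ℚ.+ ½ ℚ.* (η ℚ.* ε)))
  eq = solve 8 (λ s t u v u′ v′ η ε →
       ((s :* (u :+ ε) :+ (con 0ℚ :+ η) :* ε) :+ t :* u′) :+
       (t :* (con ½ :* (η :* ε)) :+ (s :* v :+ t :* v′)) :=
       ((s :* v :+ s :* ε) :+ t :* (v′ :+ con ½ :* (η :* ε))) :+
       (con 1ℚ :* (con ½ :* (η :* ε)) :+ ((s :* u :+ t :* u′) :+ con ½ :* (η :* ε))))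
       refl s t u v u′ v′ η ε

-- With positive weights, a gap in the first inequality cannot be made up by the second. Thus a
-- constraint tight at an inner point of a segment is tight at its ends.
weighted-tight : ∀ {s t u v u′ v′} → 0ᵣ <ᵣ s → 0ᵣ <ᵣ t → t <ᵣ 1ᵣ → u ≤ᵣ v → u′ ≤ᵣ v′ →
  s *ᵣ u +ᵣ t *ᵣ u′ ≈ᵣ s *ᵣ v +ᵣ t *ᵣ v′ → u ≈ᵣ v
weighted-tight {s} {t} {u} {v} {u′} {v′}
  (mk< (η , 0<η , η<s)) (mk< (_ , 0<γ , 0<t)) (mk< (_ , 0<γ′ , t<1)) u≤v u′≤v′ eq =
  ≤ᵣ-antisym u≤v (mk≤ λ ε 0<ε →
    let 0<κ = half-pos _ (ℚₚ.positive⁻¹ (η ℚ.* ε)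
                {{ℚₚ.pos*pos⇒pos η {{ℚ.positive 0<η}} ε {{ℚ.positive 0<ε}}}})
    in eventually₂ {λ n → (0ℚ ℚ.< seq t n × seq t n ℚ.< 1ℚ) × 0ℚ ℚ.+ η ℚ.< seq s n}
         {λ n → seq u′ n ℚ.< seq v′ n ℚ.+ ½ ℚ.* (η ℚ.* ε) ×
            seq (s *ᵣ v +ᵣ t *ᵣ v′) n ℚ.< seq (s *ᵣ u +ᵣ t *ᵣ u′) n ℚ.+ ½ ℚ.* (η ℚ.* ε)}
         (λ {n} ((0<t , t<1) , η<s) (u′< , total) →
           weighted-< (seq s n) (seq t n) (seq u n) (seq v n) (seq u′ n) (seq v′ n) η ε
             0<η 0<ε η<s 0<t t<1 u′< total)
         (eventually₂ _,_ (eventually₂ _,_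
             (eventually₁ {Q = λ n → 0ℚ ℚ.< seq t n} (λ {n} → ℚₚ.<-trans (p<p+ε 0ℚ 0<γ)) 0<t)
             (eventually₁ {Q = λ n → seq t n ℚ.< 1ℚ} (λ {n} → ℚₚ.<-trans (p<p+ε (seq t n) 0<γ′)) t<1))
           η<s)
         (eventually₂ _,_ (below u′≤v′ _ 0<κ) (below (≈⇒≥ eq) _ 0<κ)))

record Respects {n} (x y : X n) : Set where
  field
    nonneg : ∀ j .(h : j ≤ n) i → 0ᵣ ≈ᵣ x j h i → 0ᵣ ≈ᵣ y j h i
    upper  : ∀ j .(h : suc j ≤ n) (i : Fin j) →
             x j (ℕₚ.<⇒≤ h) i ≈ᵣ x (suc j) h (inject₁ i) → y j (ℕₚ.<⇒≤ h) i ≈ᵣ y (suc j) h (inject₁ i)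
    lower  : ∀ j .(h : suc j ≤ n) (i : Fin j) →
             x (suc j) h (suc i) ≈ᵣ x j (ℕₚ.<⇒≤ h) i → y (suc j) h (suc i) ≈ᵣ y j (ℕₚ.<⇒≤ h) i

convex-respects : ∀ {n} {x y z : X n} {s t} → IsGTPattern y → IsGTPattern z →
  0ᵣ <ᵣ s → 0ᵣ <ᵣ t → t <ᵣ 1ᵣ → (∀ j .(h : j ≤ n) i → x j h i ≈ᵣ s *ᵣ y j h i +ᵣ t *ᵣ z j h i) →
  Respects x y
convex-respects {s = s} {t} py pz 0<s 0<t t<1 eq = record
  { nonneg = λ j h i e → weighted-tight 0<s 0<t t<1
      (IsGTPattern.nonneg py j h i) (IsGTPattern.nonneg pz j h i)
      (≈-trans (≈-pointwise λ n →
          solve 2 (λ s t → s :* con 0ℚ :+ t :* con 0ℚ := con 0ℚ) refl (seq s n) (seq t n))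
        (≈-trans e (eq j h i)))
  ; upper = λ j h i e → weighted-tight 0<s 0<t t<1
      (IsGTPattern.upper py j h i) (IsGTPattern.upper pz j h i)
      (≈-trans (≈-sym (eq j (ℕₚ.<⇒≤ h) i)) (≈-trans e (eq (suc j) h (inject₁ i))))
  ; lower = λ j h i e → weighted-tight 0<s 0<t t<1
      (IsGTPattern.lower py j h i) (IsGTPattern.lower pz j h i)
      (≈-trans (≈-sym (eq (suc j) h (suc i))) (≈-trans e (eq j (ℕₚ.<⇒≤ h) i))) }

-- Both ends of a segment through `x` respect the constraints tight at `x`, so both equal `x`. For
-- `z` the two weights exchange roles.
vertex-criterion : ∀ {n λs μs} {x : X n} → GT λs μs x →
  (∀ y → GT λs μs y → Respects x y → y ≋ x) → IsVertex (GT λs μs) x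
vertex-criterion {n} {λs} {μs} {x} gx unique = gx , λ y z gy gz t 0<t t<1 eq →
  let y≋x = unique y gy (convex-respects (GT.isPattern gy) (GT.isPattern gz) (0<1-t t<1) 0<t t<1 eq)
      z≋x = unique z gz (convex-respects (GT.isPattern gz) (GT.isPattern gy) 0<t (0<1-t t<1) (1-t<1 0<t)
              λ j h i → ≈-trans (eq j h i) (≈-pointwise λ m →
                ℚₚ.+-comm (seq (1ᵣ -ᵣ t) m ℚ.* seq (y j h i) m) (seq t m ℚ.* seq (z j h i) m)))
  in λ j h i → ≈-trans (y≋x j h i) (≈-sym (z≋x j h i))
  where
  0<1-t : ∀ {t} → t <ᵣ 1ᵣ → 0ᵣ <ᵣ 1ᵣ -ᵣ t
  0<1-t {t} (mk< (γ , 0<γ , h)) = mk< (γ , 0<γ , eventually₁ {λ n → seq t n ℚ.+ γ ℚ.< 1ℚ}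
    (λ {n} p → lin-< (0ℚ ℚ.+ γ) (1ℚ ℚ.- seq t n) p
      (solve 2 (λ t γ → (con 0ℚ :+ γ) :+ con 1ℚ := (con 1ℚ :- t) :+ (t :+ γ)) refl (seq t n) γ)) h)
  1-t<1 : ∀ {t} → 0ᵣ <ᵣ t → 1ᵣ -ᵣ t <ᵣ 1ᵣ
  1-t<1 {t} (mk< (γ , 0<γ , h)) = mk< (γ , 0<γ , eventually₁ {λ n → 0ℚ ℚ.+ γ ℚ.< seq t n}
    (λ {n} p → lin-< ((1ℚ ℚ.- seq t n) ℚ.+ γ) 1ℚ p
      (solve 2 (λ t γ → ((con 1ℚ :- t) :+ γ) :+ t := con 1ℚ :+ (con 0ℚ :+ γ)) refl (seq t n) γ)) h)

row-sums-agree : ∀ {n λs μs} {x y : X n} → GT λs μs x → GT λs μs y →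
  ∀ j .(h : j ≤ n) → sum (x j h) ≈ᵣ sum (y j h)
row-sums-agree gx gy zero h = ≈-refl
row-sums-agree gx gy (suc j) h = +-cancelʳ (-‿cong (row-sums-agree gx gy j (ℕₚ.<⇒≤ h)))
  (≈-trans (weight-at gx j h) (≈-sym (weight-at gy j h)))

sum-fromℚ : ∀ {n} (c : Vector ℚ n) → sum (λ i → fromℚ (c i)) ≈ᵣ fromℚ (sumℚ c)
sum-fromℚ c = ≈-pointwise (go c)
  where
  go : ∀ {n} (c : Vector ℚ n) m → seq (sum (λ i → fromℚ (c i))) m ≡ sumℚ c
  go {zero} c m = refl
  go {suc n} c m = cong (c zero ℚ.+_) (go (λ i → c (suc i)) m)

HasDenominator⇒¬IsInteger : ∀ {x d} → 2 ≤ d → HasDenominator x d → ¬ IsInteger x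
HasDenominator⇒¬IsInteger 2≤d (q , x≈q , refl) (z , x≈z)
  with fromℚ-injective {q} {z ℚ./ 1} (≈-trans (≈-sym x≈q) x≈z)
-- By `↧-/` the denominator of `z / 1` times `gcd z 1` is 1, so the denominator is 1.
... | refl = ℕₚ.<⇒≱ 2≤d (ℕₚ.≤-reflexive (ℕₚ.m*n≡1⇒m≡1 _ ℤ.∣ gcd z (+ 1) ∣
  (trans (sym (ℤₚ.abs-* (ℚ.↧ (z ℚ./ 1)) (gcd z (+ 1)))) (cong ℤ.∣_∣ (ℚₚ.↧-/ z 1)))))

-- The pattern with entries over `k`

open ℕ-Solver using ()
  renaming (solve to solveℕ; _:+_ to _⊕_; _:*_ to _⊗_; _:=_ to _⊜_; con to lit)

block : ℕ → ℕ → (ℕ → ℕ) → ℕ → ℕ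
block zero    a f i       = f i
block (suc r) a f zero    = a
block (suc r) a f (suc i) = block r a f i

block-< : ∀ {r a f i} → i < r → block r a f i ≡ a
block-< {suc r} {i = zero}  _   = refl
block-< {suc r} {i = suc i} i<r = block-< (ℕ.s<s⁻¹ i<r)

block-≥ : ∀ {r a f i} → r ≤ i → block r a f i ≡ f (i ∸ r)
block-≥ {zero}          _         = refl
block-≥ {suc r} {i = suc i} (s≤s r≤i) = block-≥ r≤i

sumℕ : (n : ℕ) → (ℕ → ℕ) → ℕ
sumℕ zero    f = 0
sumℕ (suc n) f = f 0 + sumℕ n (f ∘ suc)

sumℕ-zero : ∀ (n : ℕ) → sumℕ n (λ _ → 0) ≡ 0
sumℕ-zero zero = refl
sumℕ-zero (suc n) = sumℕ-zero n

sumℕ-block : ∀ r a f n → sumℕ (r + n) (block r a f) ≡ r * a + sumℕ n f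
sumℕ-block zero    a f n = refl
sumℕ-block (suc r) a f n = trans (cong (λ s → a + s) (sumℕ-block r a f n))
  (sym (ℕₚ.+-assoc a (r * a) (sumℕ n f)))

sumℚ-/ : ∀ n f m → sumℚ {n} (λ i → (+ f (toℕ i)) ℚ./ suc m) ≡ (+ sumℕ n f) ℚ./ suc m
sumℚ-/ zero f m = sym (ℚₚ.0/n≡0 (suc m))
sumℚ-/ (suc n) f m = trans (cong ((+ f 0) ℚ./ suc m ℚ.+_) (sumℚ-/ n (f ∘ suc) m))
  (/-+ (+ f 0) (+ sumℕ n (f ∘ suc)) m)

*-/-cancel : ∀ a m → (+ (suc m * a)) ℚ./ suc m ≡ (+ a) ℚ./ 1
*-/-cancel a m = ℚₚ.fromℚᵘ-cong {mkℚᵘ (+ (suc m * a)) m} {mkℚᵘ (+ a) 0} (*≡*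
  (trans (ℤₚ.*-identityʳ _) (trans (cong +_ (ℕₚ.*-comm (suc m) a)) (ℤₚ.pos-* a (suc m)))))

suc[m]⊓n≤suc[m⊓n] : ∀ a b → suc a ⊓ b ≤ suc (a ⊓ b)
suc[m]⊓n≤suc[m⊓n] a zero = z≤n
suc[m]⊓n≤suc[m⊓n] a (suc b) = s≤s (ℕₚ.⊓-monoʳ-≤ a (ℕₚ.n≤1+n b))

suc[m]∸n≤suc[m∸n] : ∀ a b → suc a ∸ b ≤ suc (a ∸ b)
suc[m]∸n≤suc[m∸n] a zero = ℕₚ.≤-refl
suc[m]∸n≤suc[m∸n] zero (suc b) = subst (_≤ 1) (sym (ℕₚ.0∸n≡0 b)) z≤n
suc[m]∸n≤suc[m∸n] (suc a) (suc b) = suc[m]∸n≤suc[m∸n] a b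

module Pattern (m : ℕ) where
  k T B : ℕ
  k = suc m
  T = k * k
  B = m * (2 + m)

  -- The minima with `k` freeze the pattern from row `2 k + 1` on, up to added zeros. At most one
  -- summand of `c j` is non-zero: the first before row `k + 1`, the second after it.
  p r c : ℕ → ℕ
  p j = (j ∸ 1) ⊓ k
  r j = (j ∸ suc k) ⊓ k
  c j = (suc k ∸ j) + r j

  g : ℕ → ℕ → ℕ
  g j = block (r j) T (block (p j ∸ r j) B (block 1 (c j * m) (λ _ → 0)))

  r≤p : ∀ j → r j ≤ p j
  r≤p j = ℕₚ.⊓-monoˡ-≤ k (ℕₚ.∸-monoʳ-≤ j (s≤s z≤n))

  -- Indices start at 0: row j of k x consists of r copies of T = k², then copies of B = k² - 1, the
  -- entry c (k - 1) in position p, and zeros.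
  data Position (j i : ℕ) : Set where
    left  : i < r j → Position j i
    mid   : r j ≤ i → i < p j → Position j i
    pivot : i ≡ p j → Position j i
    right : p j < i → Position j i

  position : ∀ j i → Position j i
  position j i with i ℕₚ.<? r j | ℕₚ.<-cmp i (p j)
  ... | yes i<r | _              = left i<r
  ... | no i≮r  | tri< i<p _ _   = mid (ℕₚ.≮⇒≥ i≮r) i<p
  ... | no i≮r  | tri≈ _ i≡p _   = pivot i≡p
  ... | no i≮r  | tri> _ _ p<i   = right p<i

  g-left : ∀ j {i} → i < r j → g j i ≡ T
  g-left j = block-<

  g-mid : ∀ j {i} → r j ≤ i → i < p j → g j i ≡ B
  g-mid j r≤i i<p = trans (block-≥ r≤i) (block-< (ℕₚ.∸-monoˡ-< i<p r≤i))

  g-pivot : ∀ j {i} → i ≡ p j → g j i ≡ c j * m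
  g-pivot j refl = trans (block-≥ (r≤p j)) (trans (block-≥ {p j ∸ r j} ℕₚ.≤-refl)
    (cong (block 1 (c j * m) (λ _ → 0)) (ℕₚ.n∸n≡0 (p j ∸ r j))))

  g-right : ∀ j {i} → p j < i → g j i ≡ 0
  g-right j {i} p<i = trans (block-≥ {r j} (ℕₚ.≤-trans (r≤p j) (ℕₚ.<⇒≤ p<i)))
    (trans (block-≥ {p j ∸ r j} (ℕₚ.∸-monoˡ-≤ (r j) (ℕₚ.<⇒≤ p<i)))
      (block-≥ {1} (ℕₚ.m<n⇒0<n∸m (ℕₚ.∸-monoˡ-< p<i (r≤p j)))))

  T≡1+B : T ≡ suc B
  T≡1+B = eq m
    where
    eq : ∀ m → suc m * suc m ≡ suc (m * (2 + m))
    eq = solveℕ 1 (λ m → (lit 1 ⊕ m) ⊗ (lit 1 ⊕ m) ⊜ lit 1 ⊕ m ⊗ (lit 2 ⊕ m)) refl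

  B≤T : B ≤ T
  B≤T = subst (B ≤_) (sym T≡1+B) (ℕₚ.n≤1+n B)

  r≤k : ∀ j → r j ≤ k
  r≤k j = ℕₚ.m⊓n≤n (j ∸ suc k) k

  r-mono : ∀ j → r j ≤ r (suc j)
  r-mono j = ℕₚ.⊓-monoˡ-≤ k (ℕₚ.∸-monoˡ-≤ (suc k) (ℕₚ.n≤1+n j))

  r-step : ∀ j → r (suc j) ≤ suc (r j)
  r-step j = ℕₚ.≤-trans (ℕₚ.⊓-monoˡ-≤ k (suc[m]∸n≤suc[m∸n] j (suc k))) (suc[m]⊓n≤suc[m⊓n] (j ∸ suc k) k)

  r-low : ∀ {j} → j ≤ k → r (suc j) ≡ 0
  r-low j≤k = cong (_⊓ k) (ℕₚ.m≤n⇒m∸n≡0 j≤k)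

  p-low : ∀ {j} → j ≤ k → p (suc j) ≡ j
  p-low = ℕₚ.m≤n⇒m⊓n≡m

  c-low : ∀ {j} → j ≤ k → c (suc j) ≡ k ∸ j
  c-low {j} j≤k = trans (cong (λ s → (k ∸ j) + s) (r-low j≤k)) (ℕₚ.+-identityʳ (k ∸ j))

  p-high : ∀ {j} → k ≤ j → p (suc j) ≡ k
  p-high = ℕₚ.m≥n⇒m⊓n≡n

  c-high : ∀ {j} → k ≤ j → c (suc j) ≡ r (suc j)
  c-high {j} k≤j = cong (_+ r (suc j)) (ℕₚ.m≤n⇒m∸n≡0 k≤j)

  c≤k : ∀ j → c (suc j) ≤ k
  c≤k j with ℕₚ.≤-total j k
  ... | inj₁ j≤k = subst (_≤ k) (sym (c-low j≤k)) (ℕₚ.m∸n≤m k j)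
  ... | inj₂ k≤j = subst (_≤ k) (sym (c-high k≤j)) (r≤k (suc j))

  pivot≤B : ∀ j → c (suc j) * m ≤ B
  pivot≤B j = subst (c (suc j) * m ≤_) (ℕₚ.*-comm (2 + m) m)
    (ℕₚ.*-monoˡ-≤ m (ℕₚ.≤-trans (c≤k j) (ℕₚ.n≤1+n k)))

  B≤g : ∀ j {i} → i < p j → B ≤ g j i
  B≤g j {i} i<p with i ℕₚ.<? r j
  ... | yes i<r = subst (B ≤_) (sym (g-left j i<r)) B≤T
  ... | no  i≮r = ℕₚ.≤-reflexive (sym (g-mid j (ℕₚ.≮⇒≥ i≮r) i<p))

  g≤B : ∀ j {i} → r (suc j) ≤ i → g (suc j) i ≤ B
  g≤B j {i} r≤i with position (suc j) i
  ... | left i<r    = contradiction r≤i (ℕₚ.<⇒≱ i<r)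
  ... | mid _ i<p   = ℕₚ.≤-reflexive (g-mid (suc j) r≤i i<p)
  ... | pivot i≡p   = subst (_≤ B) (sym (g-pivot (suc j) i≡p)) (pivot≤B j)
  ... | right p<i   = subst (_≤ B) (sym (g-right (suc j) p<i)) z≤n

  g≤T : ∀ j i → g (suc j) i ≤ T
  g≤T j i with i ℕₚ.<? r (suc j)
  ... | yes i<r = ℕₚ.≤-reflexive (g-left (suc j) i<r)
  ... | no  i≮r = ℕₚ.≤-trans (g≤B j (ℕₚ.≮⇒≥ i≮r)) B≤T

  T≤g : ∀ j {i} → i < r j → T ≤ g j i
  T≤g j i<r = ℕₚ.≤-reflexive (sym (g-left j i<r))

  pivot≤g : ∀ j {i a} → i ≡ p j → a ≤ c j → a * m ≤ g j i
  pivot≤g j {i} {a} i≡p a≤c = subst (a * m ≤_) (sym (g-pivot j i≡p)) (ℕₚ.*-monoˡ-≤ m a≤c)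

  p-high-const : ∀ {j} → k ≤ j → p (suc (suc j)) ≡ p (suc j)
  p-high-const k≤j = trans (p-high (ℕₚ.m≤n⇒m≤1+n k≤j)) (sym (p-high k≤j))

  -- While `j < k`, row `j + 1` is at most `B` and all but the last entry of the next row are at
  -- least `B`. Afterwards the pivot stays in its column and `r` can only grow.
  g-upper : ∀ j {i} → i ≤ j → g (suc j) i ≤ g (suc (suc j)) i
  g-upper j {i} i≤j with j ℕₚ.<? k
  ... | yes j<k = ℕₚ.≤-trans
    (g≤B j (subst (_≤ i) (sym (r-low (ℕₚ.<⇒≤ j<k))) z≤n))
    (B≤g (suc (suc j)) (subst (i <_) (sym (p-low j<k)) (s≤s i≤j)))
  ... | no j≮k with ℕₚ.≮⇒≥ j≮k | position (suc j) i
  ... | k≤j | left i<r = ℕₚ.≤-trans (g≤T j i) (T≤g (suc (suc j)) (ℕₚ.<-≤-trans i<r (r-mono (suc j))))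
  ... | k≤j | mid r≤i i<p = ℕₚ.≤-trans (g≤B j r≤i)
          (B≤g (suc (suc j)) (subst (i <_) (sym (p-high-const k≤j)) i<p))
  ... | k≤j | pivot i≡p = subst (_≤ g (suc (suc j)) i) (sym (g-pivot (suc j) i≡p))
          (pivot≤g (suc (suc j)) (trans i≡p (sym (p-high-const k≤j)))
            (subst₂ _≤_ (sym (c-high k≤j)) (sym (c-high (ℕₚ.m≤n⇒m≤1+n k≤j))) (r-mono (suc j))))
  ... | k≤j | right p<i = subst (_≤ g (suc (suc j)) i) (sym (g-right (suc j) p<i)) z≤n

  -- Along a diagonal, `r` and `p` grow by at most one per row, so no block is left too early. The
  -- pivot meets the previous pivot, with smaller `c`, while `j < k`; later it meets an entry that
  -- is at least `B`.
  g-lower : ∀ j {i} → i ≤ j → g (suc (suc j)) (suc i) ≤ g (suc j) i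
  g-lower j {i} i≤j with position (suc (suc j)) (suc i)
  ... | left 1+i<r = ℕₚ.≤-trans (g≤T (suc j) (suc i))
          (T≤g (suc j) (ℕ.s<s⁻¹ (ℕₚ.<-≤-trans 1+i<r (r-step (suc j)))))
  ... | mid r≤1+i 1+i<p = ℕₚ.≤-trans (g≤B (suc j) r≤1+i)
          (B≤g (suc j) (ℕ.s<s⁻¹ (ℕₚ.<-≤-trans 1+i<p (suc[m]⊓n≤suc[m⊓n] j k))))
  ... | right p<1+i = subst (_≤ g (suc j) i) (sym (g-right (suc (suc j)) p<1+i)) z≤n
  ... | pivot 1+i≡p with j ℕₚ.<? k
  ... | no j≮k = subst (_≤ g (suc j) i) (sym (g-pivot (suc (suc j)) 1+i≡p)) (ℕₚ.≤-trans (pivot≤B (suc j))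
          (B≤g (suc j) (ℕₚ.≤-reflexive (trans 1+i≡p (p-high-const (ℕₚ.≮⇒≥ j≮k))))))
  ... | yes j<k = subst (_≤ g (suc j) i) (sym (g-pivot (suc (suc j)) 1+i≡p))
          (pivot≤g (suc j) (trans (ℕₚ.suc-injective (trans 1+i≡p (p-low j<k)))
              (sym (p-low (ℕₚ.<⇒≤ j<k))))
            (subst₂ _≤_ (sym (c-low j<k)) (sym (c-low (ℕₚ.<⇒≤ j<k))) (ℕₚ.∸-monoʳ-≤ k (ℕₚ.n≤1+n j))))

  -- These are the row sums before scaling by `k`. As they are natural numbers, the weights are
  -- integers.
  S : ℕ → ℕ
  S zero    = 0
  S (suc j) = r (suc j) + m * suc (p (suc j))

  -- Writing `T` as `1 + B` turns the two blocks into `R + P * B`. The factor `k` then comes from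
  -- `B = m * (k + 1)`: up to row `k + 1` with a pivot of `(k - j) * m`, later with `P = k` and a
  -- pivot of `R * m`.
  row-sum : ∀ (j : ℕ) → sumℕ j (g j) ≡ k * S j
  row-sum zero = sym (ℕₚ.*-zeroʳ k)
  row-sum (suc j) = begin
    sumℕ (suc j) (g (suc j))
      ≡⟨ cong (λ l → sumℕ l (g (suc j))) split ⟩
    sumℕ (R + (E + (1 + (j ∸ P)))) (g (suc j))
      ≡⟨ sumℕ-block R T _ _ ⟩
    R * T + sumℕ (E + (1 + (j ∸ P))) (block E B (block 1 L (λ _ → 0)))
      ≡⟨ cong (λ s → R * T + s) (sumℕ-block E B _ _) ⟩
    R * T + (E * B + (L + sumℕ (j ∸ P) (λ _ → 0)))
      ≡⟨ cong₂ (λ t z → R * t + (E * B + (L + z))) T≡1+B (sumℕ-zero (j ∸ P)) ⟩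
    R * suc B + (E * B + (L + 0))
      ≡⟨ eq₁ R E B L ⟩
    R + ((E + R) * B + L)
      ≡⟨ cong (λ q → R + (q * B + L)) (ℕₚ.m∸n+n≡m (r≤p (suc j))) ⟩
    R + (P * B + L)
      ≡⟨ total ⟩
    k * (R + m * suc P) ∎
    where
    open ≡-Reasoning
    R P E L : ℕ
    R = r (suc j)
    P = p (suc j)
    E = P ∸ R
    L = c (suc j) * m
    split : suc j ≡ R + (E + (1 + (j ∸ P)))
    split = sym (begin
      R + (E + (1 + (j ∸ P)))  ≡⟨ ℕₚ.+-assoc R E (1 + (j ∸ P)) ⟨
      R + E + (1 + (j ∸ P))    ≡⟨ cong (_+ (1 + (j ∸ P))) (ℕₚ.m+[n∸m]≡n (r≤p (suc j))) ⟩
      P + (1 + (j ∸ P))        ≡⟨ ℕₚ.+-suc P (j ∸ P) ⟩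
      suc (P + (j ∸ P))        ≡⟨ cong suc (ℕₚ.m+[n∸m]≡n (ℕₚ.m⊓n≤m j k)) ⟩
      suc j ∎)
    eq₁ : ∀ R E B L → R * suc B + (E * B + (L + 0)) ≡ R + ((E + R) * B + L)
    eq₁ = solveℕ 4 (λ R E B L → R ⊗ (lit 1 ⊕ B) ⊕ (E ⊗ B ⊕ (L ⊕ lit 0)) ⊜ R ⊕ ((E ⊕ R) ⊗ B ⊕ L)) refl
    eq-low : ∀ m j e → suc m ≡ j + e → 0 + (j * (m * (2 + m)) + e * m) ≡ suc m * (0 + m * suc j)
    eq-low m j e m+1≡j+e = begin
      0 + (j * (m * (2 + m)) + e * m)
        ≡⟨ solveℕ 3 (λ m j e → j ⊗ (m ⊗ (lit 2 ⊕ m)) ⊕ e ⊗ m ⊜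
             j ⊗ m ⊗ (lit 1 ⊕ m) ⊕ (j ⊕ e) ⊗ m) refl m j e ⟩
      j * m * suc m + (j + e) * m
        ≡⟨ cong (λ s → j * m * suc m + s * m) m+1≡j+e ⟨
      j * m * suc m + suc m * m
        ≡⟨ solveℕ 2 (λ m j → j ⊗ m ⊗ (lit 1 ⊕ m) ⊕ (lit 1 ⊕ m) ⊗ m ⊜
             (lit 1 ⊕ m) ⊗ (m ⊗ (lit 1 ⊕ j))) refl m j ⟩
      suc m * (m * suc j) ∎
    eq-high : ∀ m R → R + (suc m * (m * (2 + m)) + R * m) ≡ suc m * (R + m * suc (suc m))
    eq-high = solveℕ 2 (λ m R → R ⊕ ((lit 1 ⊕ m) ⊗ (m ⊗ (lit 2 ⊕ m)) ⊕ R ⊗ m) ⊜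
      (lit 1 ⊕ m) ⊗ (R ⊕ m ⊗ (lit 2 ⊕ m))) refl
    total : R + (P * B + L) ≡ k * (R + m * suc P)
    total with ℕₚ.≤-total j k
    ... | inj₁ j≤k rewrite c-low j≤k | r-low j≤k | p-low j≤k =
      eq-low m j (k ∸ j) (sym (ℕₚ.m+[n∸m]≡n j≤k))
    ... | inj₂ k≤j rewrite c-high k≤j | p-high k≤j = eq-high m (r (suc j))

-- `λᵏ` on all natural indices, so that it also gives the top rows padded with zeros.
stair : ℕ → ℕ → ℤ
stair k i with ℕₚ.<-cmp i k
... | tri< _ _ _ = + k
... | tri≈ _ _ _ = + k ℤ.- 1ℤ
... | tri> _ _ _ = 0ℤ

λᵏ≡stair : ∀ k i → λᵏ k i ≡ stair k (toℕ i)
λᵏ≡stair k i with ℕₚ.<-cmp (toℕ i) k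
... | tri< _ _ _ = refl
... | tri≈ _ _ _ = refl
... | tri> _ _ _ = refl

-- No division by the number of indices in `P`: if `a < b`, then `u ≤ v` everywhere, and equal sums
-- force `v ≤ u` at `zero`, that is `b ≤ a`. The other case is symmetric.
sum-determines-const : ∀ {n} {u v : Vector ℝ (suc n)} {P : Fin (suc n) → Set} {a b} →
  P zero → sum u ≈ᵣ sum v →
  (∀ i → P i ⊎ u i ≈ᵣ v i) → (∀ i → P i → u i ≈ᵣ a) → (∀ i → P i → v i ≈ᵣ b) → a ≈ᵣ b
sum-determines-const {n} {u} {v} {P} {a} {b} p₀ sums cases u≈a v≈b =
  ≤ᵣ-antisym (≮⇒≥ λ b<a → ≤∧>⇒⊥ (squeeze {v} {u} (≈-sym sums) swap v≈b u≈a (<⇒≤ᵣ b<a)) b<a)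
            (≮⇒≥ λ a<b → ≤∧>⇒⊥ (squeeze {u} {v} sums cases u≈a v≈b (<⇒≤ᵣ a<b)) a<b)
  where
  swap : ∀ i → P i ⊎ v i ≈ᵣ u i
  swap i with cases i
  ... | inj₁ p = inj₁ p
  ... | inj₂ e = inj₂ (≈-sym e)
  squeeze : ∀ {u v : Vector ℝ (suc n)} {a b} → sum u ≈ᵣ sum v → (∀ i → P i ⊎ u i ≈ᵣ v i) →
    (∀ i → P i → u i ≈ᵣ a) → (∀ i → P i → v i ≈ᵣ b) → a ≤ᵣ b → b ≤ᵣ a
  squeeze sums cases u≈a v≈b a≤b = ≤ᵣ-trans (≈⇒≥ (v≈b zero p₀)) (≤ᵣ-trans
    (sum-determines-≤ zero (≈⇒≥ sums) λ i _ → le i (cases i)) (≈⇒≤ (u≈a zero p₀)))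
    where
    le : ∀ i → P i ⊎ _ ≈ᵣ _ → _ ≤ᵣ _
    le i (inj₁ p) = ≤ᵣ-trans (≈⇒≤ (u≈a i p)) (≤ᵣ-trans a≤b (≈⇒≥ (v≈b i p)))
    le i (inj₂ e) = ≈⇒≤ e

-- Rigidity of the pattern and its denominator

module Vertex (m : ℕ) (n : ℕ) (2k<n : suc m + suc m < n) (λs μs : Vector ℤ n) where
  open Pattern m

  -- Abstract, since unification would otherwise unfold the normalisation of fractions.
  abstract
    entry : ℕ → ℝ
    entry a = fromℚ ((+ a) ℚ./ k)

    entry-≈ : ∀ a → entry a ≈ᵣ fromℚ ((+ a) ℚ./ k)
    entry-≈ a = ≈-refl

    entry-mono : ∀ {a b} → a ≤ b → entry a ≤ᵣ entry b
    entry-mono a≤b = ≤-pointwise λ _ → /-≤ m (ℤ.+≤+ a≤b)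

    entry-zero : entry 0 ≈ᵣ 0ᵣ
    entry-zero = ≈-pointwise λ _ → ℚₚ.0/n≡0 k

  entry-cong : ∀ {a b} → a ≡ b → entry a ≈ᵣ entry b
  entry-cong refl = ≈-refl

  x : X n
  x j h i = entry (g j (toℕ i))

  isPattern : IsGTPattern x
  isPattern = record
    { nonneg = λ j h i → ≤ᵣ-trans (≈⇒≥ entry-zero) (entry-mono z≤n)
    ; upper = λ { (suc j) h i → entry-mono (subst (λ l → g (suc j) (toℕ i) ≤ g (suc (suc j)) l)
                                  (sym (toℕ-inject₁ i)) (g-upper j (toℕ≤pred[n] i))) }
    ; lower = λ { (suc j) h i → entry-mono (g-lower j (toℕ≤pred[n] i)) } }

  row-sum-x : ∀ j .(h : j ≤ n) → sum (x j h) ≈ᵣ fromℤ (+ S j)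
  row-sum-x j h = ≈-trans (sum-cong {j} (λ i → entry-≈ (g j (toℕ i)))) $
    ≈-trans (sum-fromℚ {j} (λ i → (+ g j (toℕ i)) ℚ./ k)) (≈-pointwise λ _ →
    trans (sumℚ-/ j (g j) m) (trans (cong (λ s → (+ s) ℚ./ k) (row-sum j)) (*-/-cancel (S j) m)))

  r-top : ∀ {l} → k + k < l → r l ≡ k
  r-top {suc l} (s≤s 2k≤l) = ℕₚ.m≥n⇒m⊓n≡n (subst (_≤ l ∸ k) (ℕₚ.m+n∸n≡m k k) (ℕₚ.∸-monoˡ-≤ k 2k≤l))

  p-top : ∀ {l} → k + k < l → p l ≡ k
  p-top {suc l} (s≤s 2k≤l) = p-high (ℕₚ.≤-trans (ℕₚ.m≤m+n k k) 2k≤l)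

  c-top : ∀ {l} → k + k < l → c l ≡ k
  c-top {suc l} (s≤s 2k≤l) = trans (c-high (ℕₚ.≤-trans (ℕₚ.m≤m+n k k) 2k≤l)) (r-top (s≤s 2k≤l))

  -- Beyond row `2 k`, all of `r`, `p` and `c` equal `k`: no copy of `B` is left, and the pivot is
  -- `k * m / k`.
  top-value : ∀ {l} → k + k < l → ∀ i → (+ g l i) ℚ./ k ≡ stair k i ℚ./ 1
  top-value {l} 2k<l i with ℕₚ.<-cmp i k
  ... | tri< i<k _ _ = trans
    (cong (λ a → (+ a) ℚ./ k) (g-left l (subst (i <_) (sym (r-top 2k<l)) i<k))) (*-/-cancel k m)
  ... | tri≈ _ i≡k _ = trans
    (cong (λ a → (+ a) ℚ./ k)
      (trans (g-pivot l (trans i≡k (sym (p-top 2k<l)))) (cong (_* m) (c-top 2k<l))))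
    (*-/-cancel m m)
  ... | tri> _ _ k<i = trans
    (cong (λ a → (+ a) ℚ./ k) (g-right l (subst (_< i) (sym (p-top 2k<l)) k<i))) (ℚₚ.0/n≡0 k)

  -- Pointwise equations let the same argument serve `λᵏ`, `μᵏ` and the weights for larger `n`.
  module _ (λs≡ : ∀ i → λs i ≡ stair k (toℕ i))
           (μs≡ : ∀ i → μs i ≡ (+ S (suc (toℕ i))) ℤ.- (+ S (toℕ i))) where

    x∈GT : GT λs μs x
    x∈GT = record
      { isPattern = isPattern
      ; top = λ i → ≈-trans (entry-≈ (g n (toℕ i))) $ ≈-pointwise λ _ →
          trans (top-value 2k<n (toℕ i)) (cong (ℚ._/ 1) (sym (λs≡ i)))
      ; weight = λ j → ≈-trans
          (sub-cong (row-sum-x (suc (toℕ j)) (toℕ<n j)) (row-sum-x (toℕ j) (ℕₚ.<⇒≤ (toℕ<n j))))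
          (≈-trans (fromℤ-minus (+ S (suc (toℕ j))) (+ S (toℕ j)))
            (≈-pointwise λ _ → cong (ℚ._/ 1) (sym (μs≡ j)))) }

    module Unique (y : X n) (y∈GT : GT λs μs y) (tight : Respects x y) where
      k<n : suc k ≤ n
      k<n = ℕₚ.≤-trans (s≤s (ℕₚ.m≤m+n k k)) 2k<n

      y-upper : ∀ j .(h : suc j ≤ n) (i : Fin j) → g j (toℕ i) ≡ g (suc j) (toℕ i) →
        y j (ℕₚ.<⇒≤ h) i ≈ᵣ y (suc j) h (inject₁ i)
      y-upper j h i eq = Respects.upper tight j h i
        (entry-cong (trans eq (cong (g (suc j)) (sym (toℕ-inject₁ i)))))

      Agrees : ∀ j → .(j ≤ n) → Fin j → Set
      Agrees j h i = y j h i ≈ᵣ x j h i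

      -- Equal entries of `x` in one column of adjacent rows form a tight constraint, which `y`
      -- respects; so agreement spreads along the column.
      agrees-down : ∀ j .(h : suc j ≤ n) (i : Fin j) → g j (toℕ i) ≡ g (suc j) (toℕ i) →
        Agrees (suc j) h (inject₁ i) → Agrees j (ℕₚ.<⇒≤ h) i
      agrees-down j h i eq ag = ≈-trans (y-upper j h i eq)
        (≈-trans ag (entry-cong (trans (cong (g (suc j)) (toℕ-inject₁ i)) (sym eq))))

      agrees-up : ∀ j .(h : suc j ≤ n) (i : Fin j) → g j (toℕ i) ≡ g (suc j) (toℕ i) →
        Agrees j (ℕₚ.<⇒≤ h) i → Agrees (suc j) h (inject₁ i)
      agrees-up j h i eq ag = ≈-trans (≈-sym (y-upper j h i eq))
        (≈-trans ag (entry-cong (trans eq (cong (g (suc j)) (sym (toℕ-inject₁ i))))))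

      -- Induction on the distance `s` to the top row, which is prescribed. Going up the column
      -- never leaves the block, as `r` is monotone.
      agrees-left : ∀ s j .(h : j ≤ n) → s + j ≡ n → (i : Fin j) → toℕ i < r j → Agrees j h i
      agrees-left zero j h refl i i<r = ≈-trans (GT.top y∈GT i) (≈-sym (GT.top x∈GT i))
      agrees-left (suc s) j h s+j≡n i i<r = agrees-down j j<n i
        (trans (g-left j i<r) (sym (g-left (suc j) i<r′)))
        (agrees-left s (suc j) j<n (trans (ℕₚ.+-suc s j) s+j≡n) (inject₁ i)
          (subst (_< r (suc j)) (sym (toℕ-inject₁ i)) i<r′))
        where
        j<n : j < n
        j<n = subst (suc j ≤_) s+j≡n (s≤s (ℕₚ.m≤n+m j s))
        i<r′ : toℕ i < r (suc j)
        i<r′ = ℕₚ.<-≤-trans i<r (r-mono j)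

      agrees-right : ∀ j .(h : j ≤ n) i → p j < toℕ i → Agrees j h i
      agrees-right j h i p<i = ≈-trans (≈-sym (Respects.nonneg tight j h i (≈-sym x≈0))) (≈-sym x≈0)
        where x≈0 = ≈-trans (entry-cong (g-right j p<i)) entry-zero

      g-mid-low : ∀ {j i} → j ≤ k → i < j → g (suc j) i ≡ B
      g-mid-low {j} {i} j≤k i<j =
        g-mid (suc j) (subst (_≤ i) (sym (r-low j≤k)) z≤n) (subst (i <_) (sym (p-low j≤k)) i<j)

      -- Neighbours in row `k + 1` are both linked to the entry of row `k` between them, which is
      -- `b` in `x` as well.
      middle-row-equal : ∀ i → toℕ i < k → y (suc k) k<n i ≈ᵣ y (suc k) k<n zero
      middle-row-equal = <-weakInduction (λ i → toℕ i < k → y (suc k) k<n i ≈ᵣ y (suc k) k<n zero)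
        (λ _ → ≈-refl)
        λ i ih 1+i<k →
          let i<k = ℕₚ.<-trans (ℕₚ.n<1+n (toℕ i)) 1+i<k
              in-row-k = g-mid-low (ℕₚ.n≤1+n m) (ℕ.s<s⁻¹ 1+i<k)
          in ≈-trans
            (Respects.lower tight k k<n i
              (entry-cong (trans (g-mid-low ℕₚ.≤-refl 1+i<k) (sym in-row-k))))
            (≈-trans
              (y-upper k k<n i (trans in-row-k (sym (g-mid-low ℕₚ.≤-refl i<k))))
              (ih (subst (_< k) (sym (toℕ-inject₁ i)) i<k)))

      -- The last entry of row `k + 1` is the pivot with `c = 0`, a tight zero. The others are
      -- constant in `x` and in `y`, so the row sum fixes their value.
      agrees-middle : ∀ i → toℕ i < k → Agrees (suc k) k<n i
      agrees-middle i i<k = ≈-trans (middle-row-equal i i<k)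
        (≈-trans (sum-determines-const {P = λ i → toℕ i < k} z<s
          (row-sums-agree y∈GT x∈GT (suc k) k<n) cases middle-row-equal
          (λ i i<k → entry-cong (g-mid-low ℕₚ.≤-refl i<k)))
          (entry-cong (sym (g-mid-low ℕₚ.≤-refl i<k))))
        where
        cases : ∀ i → toℕ i < k ⊎ Agrees (suc k) k<n i
        cases i with toℕ i ℕₚ.<? k
        ... | yes i<k = inj₁ i<k
        ... | no  i≮k = inj₂ (≈-trans
          (≈-sym (Respects.nonneg tight (suc k) k<n i (≈-sym x≈0))) (≈-sym x≈0))
          where
          i≡p : toℕ i ≡ p (suc k)
          i≡p = trans (ℕₚ.≤-antisym (toℕ≤pred[n] i) (ℕₚ.≮⇒≥ i≮k)) (sym (p-low {k} ℕₚ.≤-refl))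
          c≡0 : c (suc k) ≡ 0
          c≡0 = trans (c-low {k} ℕₚ.≤-refl) (ℕₚ.n∸n≡0 k)
          x≈0 = ≈-trans (entry-cong (trans (g-pivot (suc k) i≡p) (cong (_* m) c≡0))) entry-zero

      agrees-mid-low : ∀ s j .(h : suc j ≤ n) → s + j ≡ k → ∀ i → toℕ i < j → Agrees (suc j) h i
      agrees-mid-low zero j h refl i i<j = agrees-middle i i<j
      agrees-mid-low (suc s) j h s+j≡k i i<j = agrees-down (suc j) 1+j<n i
        (trans (g-mid-low (ℕₚ.<⇒≤ j<k) i<j) (sym (g-mid-low j<k (ℕₚ.m≤n⇒m≤1+n i<j))))
        (agrees-mid-low s (suc j) 1+j<n (trans (ℕₚ.+-suc s j) s+j≡k) (inject₁ i)
          (subst (_< suc j) (sym (toℕ-inject₁ i)) (ℕₚ.m≤n⇒m≤1+n i<j)))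
        where
        j<k : j < k
        j<k = subst (suc j ≤_) s+j≡k (s≤s (ℕₚ.m≤n+m j s))
        1+j<n : suc j < n
        1+j<n = ℕₚ.≤-trans (s≤s j<k) k<n

      -- Induction upwards from row `k + 1`: since `r` grows, an index outside the left block was
      -- outside it one row earlier. There it is `i′`, available because `i < k ≤ j`.
      agrees-mid-high : ∀ t j .(h : suc j ≤ n) → j ≡ t + k → ∀ i →
        r (suc j) ≤ toℕ i → toℕ i < k → Agrees (suc j) h i
      agrees-mid-high zero j h refl i r≤i i<k = agrees-middle i i<k
      agrees-mid-high (suc t) (suc j) h refl i r≤i i<k =
        subst (Agrees (suc (suc j)) h) inject₁-i′≡i
          (agrees-up (suc j) h i′
            (trans (g-mid (suc j) r≤i₁ i′<p) (sym (g-mid (suc (suc j)) r≤i₂ i′<p₂)))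
            (agrees-mid-high t j (ℕₚ.<⇒≤ h) refl i′ r≤i₁ (subst (_< k) (sym i′≡i) i<k)))
        where
        k≤j : k ≤ j
        k≤j = ℕₚ.m≤n+m k t
        i<1+j : toℕ i < suc j
        i<1+j = ℕₚ.m≤n⇒m≤1+n (ℕₚ.≤-trans i<k k≤j)
        i′ : Fin (suc j)
        i′ = fromℕ< i<1+j
        i′≡i : toℕ i′ ≡ toℕ i
        i′≡i = toℕ-fromℕ< i<1+j
        inject₁-i′≡i : inject₁ i′ ≡ i
        inject₁-i′≡i = toℕ-injective (trans (toℕ-inject₁ i′) i′≡i)
        r≤i₂ : r (suc (suc j)) ≤ toℕ i′
        r≤i₂ = subst (r (suc (suc j)) ≤_) (sym i′≡i) r≤i
        r≤i₁ : r (suc j) ≤ toℕ i′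
        r≤i₁ = ℕₚ.≤-trans (r-mono (suc j)) r≤i₂
        i′<p : toℕ i′ < p (suc j)
        i′<p = subst₂ _<_ (sym i′≡i) (sym (p-high k≤j)) i<k
        i′<p₂ : toℕ i′ < p (suc (suc j))
        i′<p₂ = subst₂ _<_ (sym i′≡i) (sym (p-high (ℕₚ.m≤n⇒m≤1+n k≤j))) i<k

      agrees-off-pivot : ∀ j .(h : suc j ≤ n) i → toℕ i ≢ p (suc j) → Agrees (suc j) h i
      agrees-off-pivot j h i i≢p with position (suc j) (toℕ i)
      ... | left i<r  = agrees-left (n ∸ suc j) (suc j) h (ℕₚ.m∸n+n≡m h′) i i<r
        -- `h` is irrelevant; decidability recovers a proof that the subtraction can use.
        where h′ = recompute (suc j ℕₚ.≤? n) h
      ... | pivot i≡p = contradiction i≡p i≢p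
      ... | right p<i = agrees-right (suc j) h i p<i
      ... | mid r≤i i<p with ℕₚ.≤-total j k
      ... | inj₁ j≤k =
        agrees-mid-low (k ∸ j) j h (ℕₚ.m∸n+n≡m j≤k) i (subst (toℕ i <_) (p-low j≤k) i<p)
      ... | inj₂ k≤j =
        agrees-mid-high (j ∸ k) j h (sym (ℕₚ.m∸n+n≡m k≤j)) i r≤i (subst (toℕ i <_) (p-high k≤j) i<p)

      -- Only the pivot of each row is still open, and the row sum determines it.
      agrees : y ≋ x
      agrees (suc j) h i with toℕ i ℕₚ.≟ p (suc j)
      ... | no i≢p = agrees-off-pivot j h i i≢p
      ... | yes i≡p = sum-determines i (row-sums-agree y∈GT x∈GT (suc j) h) λ i′ i′≢i →
        agrees-off-pivot j h i′ λ i′≡p → i′≢i (toℕ-injective (trans i′≡p (sym i≡p)))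

    x-vertex : IsVertex (GT λs μs) x
    x-vertex = vertex-criterion x∈GT Unique.agrees

  -- A common divisor of `B` and `k` divides `k * k = B + 1`, hence 1. So `B / k` is in lowest
  -- terms.
  x-denominator : .(h : suc k ≤ n) → HasDenominator (x (suc k) h zero) k
  x-denominator h =
    q , ≈-trans (entry-cong g≡B) (≈-trans (entry-≈ B) $ ≈-pointwise λ _ → ℚₚ.↥p/↧p≡p q) , refl
    where
    coprime : Coprime B k
    coprime {d} (d∣B , d∣k) = ∣1⇒≡1
      (∣m+n∣m⇒∣n (subst (d ∣_) (trans T≡1+B (ℕₚ.+-comm 1 B)) (∣m⇒∣m*n k d∣k)) d∣B)
    q : ℚ
    q = mkℚ (+ B) m coprime
    g≡B : g (suc k) 0 ≡ B
    g≡B = g-mid (suc k) (subst (_≤ 0) (sym (r-low {k} ℕₚ.≤-refl)) z≤n)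
      (subst (0 <_) (sym (p-low {k} ℕₚ.≤-refl)) z<s)

-- The explicit weights and the conclusion

[m+n]-n≡m : ∀ a b → (+ (a + b)) ℤ.- (+ b) ≡ + a
[m+n]-n≡m a b = trans (cong (ℤ._- (+ b)) (ℤₚ.pos-+ a b)) (trans (ℤₚ.+-assoc (+ a) (+ b) (ℤ.- (+ b)))
  (trans (cong (λ z → (+ a) ℤ.+ z) (ℤₚ.+-inverseʳ (+ b))) (ℤₚ.+-identityʳ (+ a))))

module _ (m : ℕ) where
  open Pattern m

  -- Here `r` is 0 and `p` grows by one. The case `l = k` is included, which accounts for the
  -- `k + 1` copies of `k - 1` in `μᵏ`.
  S-low : ∀ l → l ≤ k → S (suc l) ≡ m + S l
  S-low zero    _ = trans (ℕₚ.*-identityʳ m) (sym (ℕₚ.+-identityʳ m))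
  S-low (suc l) l<k rewrite r-low l<k | p-low l<k | r-low (ℕₚ.<⇒≤ l<k) | p-low (ℕₚ.<⇒≤ l<k) =
    ℕₚ.*-suc m (suc l)

  -- The pivot column is fixed, and `r` grows by one until it reaches `k` in row `2 k + 1`.
  S-high : ∀ l → k < l → l ≤ k + k → S (suc l) ≡ suc (S l)
  S-high (suc l) (s≤s k≤l) l<2k = cong₂ (λ a b → a + m * suc b) r-step≡ (p-high-const k≤l)
    where
    1+[l∸k]≡ : suc l ∸ k ≡ suc (l ∸ k)
    1+[l∸k]≡ = ℕₚ.+-∸-assoc 1 k≤l
    1+[l∸k]≤k : suc (l ∸ k) ≤ k
    1+[l∸k]≤k = subst₂ _≤_ 1+[l∸k]≡ (ℕₚ.m+n∸n≡m k k) (ℕₚ.∸-monoˡ-≤ k l<2k)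
    r-step≡ : r (suc (suc l)) ≡ suc (r (suc l))
    r-step≡ = trans (cong (_⊓ k) 1+[l∸k]≡) (trans (ℕₚ.m≤n⇒m⊓n≡m 1+[l∸k]≤k)
      (cong suc (sym (ℕₚ.m≤n⇒m⊓n≡m (ℕₚ.<⇒≤ 1+[l∸k]≤k)))))

  2k+1≡1+k+k : 2 * k + 1 ≡ suc (k + k)
  2k+1≡1+k+k = trans (ℕₚ.+-comm (2 * k) 1) (cong (λ s → suc (k + s)) (ℕₚ.+-identityʳ k))

  μᵏ≡S-difference : ∀ i → μᵏ k i ≡ (+ S (suc (toℕ i))) ℤ.- (+ S (toℕ i))
  μᵏ≡S-difference i with toℕ i | toℕ<n i
  ... | l | l<2k+1 with l ℕ.≤ᵇ k | ℕₚ.≤ᵇ-reflects-≤ l k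
  ... | true  | ofʸ l≤k = sym (trans (cong (λ s → (+ s) ℤ.- (+ S l)) (S-low l l≤k)) ([m+n]-n≡m m (S l)))
  ... | false | ofⁿ l≰k = sym (trans (cong (λ s → (+ s) ℤ.- (+ S l))
          (S-high l (ℕₚ.≰⇒> l≰k) (ℕₚ.≤-pred (subst (l <_) 2k+1≡1+k+k l<2k+1)))) ([m+n]-n≡m 1 (S l)))

  λᵏμᵏ-vertex : ∃ λ (x : X (2 * k + 1)) → IsVertex (GT (λᵏ k) (μᵏ k)) x ×
    (∃ λ j → ∃ λ (h : j ≤ 2 * k + 1) → ∃ λ i → HasDenominator (x j h i) k)
  λᵏμᵏ-vertex = x , x-vertex (λᵏ≡stair k) μᵏ≡S-difference , suc k , k<n , zero , x-denominator k<n
    where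
    2k<2k+1 : k + k < 2 * k + 1
    2k<2k+1 = ℕₚ.≤-reflexive (sym 2k+1≡1+k+k)
    open Vertex m (2 * k + 1) 2k<2k+1 (λᵏ k) (μᵏ k)
    k<n : suc k ≤ 2 * k + 1
    k<n = ℕₚ.≤-trans (s≤s (ℕₚ.m≤m+n k k)) 2k<2k+1

  vertex-with-denominator : ∀ n → k + k < n →
    ∃ λ (λs : Vector ℤ n) → ∃ λ (μs : Vector ℤ n) → ∃ λ (x : X n) → IsVertex (GT λs μs) x ×
    (∃ λ j → ∃ λ (h : j ≤ n) → ∃ λ i → HasDenominator (x j h i) k)
  vertex-with-denominator n 2k<n =
    λs , μs , x , x-vertex (λ _ → refl) (λ _ → refl) , suc k , k<n , zero , x-denominator k<n
    where
    λs μs : Vector ℤ n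
    λs i = stair k (toℕ i)
    μs i = (+ S (suc (toℕ i))) ℤ.- (+ S (toℕ i))
    open Vertex m n 2k<n λs μs
    k<n : suc k ≤ n
    k<n = ℕₚ.≤-trans (s≤s (ℕₚ.m≤m+n k k)) 2k<n

theorem1p7 : (∀ n → 1 ≤ n → n ≤ 4 → ∀ (λs μs : Vector ℤ n) (x : X n) → IsVertex (GT λs μs) x →
    ∀ j .(h : j ≤ n) i → IsInteger (x j h i))
    ×
    (∀ n → 5 ≤ n → ∃ λ (λs : Vector ℤ n) → ∃ λ (μs : Vector ℤ n) → ∃ λ (x : X n) →
    IsVertex (GT λs μs) x × (∃ λ j → ∃ λ (h : j ≤ n) → ∃ λ i → ¬ IsInteger (x j h i)))
    ×
    ((∀ D → ∃ λ N → ∀ n → N ≤ n →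
    ∃ λ (λs : Vector ℤ n) → ∃ λ (μs : Vector ℤ n) → ∃ λ (x : X n) →
    IsVertex (GT λs μs) x ×
    (∃ λ j → ∃ λ (h : j ≤ n) → ∃ λ i → ∃ λ d → D ≤ d × HasDenominator (x j h i) d))
    ×
    (∀ k → 1 ≤ k → ∃ λ (x : X (2 * k + 1)) →
    IsVertex (GT (λᵏ k) (μᵏ k)) x ×
    (∃ λ j → ∃ λ (h : j ≤ 2 * k + 1) → ∃ λ i → HasDenominator (x j h i) k)))
theorem1p7 =
  vertex-IsInteger ,
  -- The argument 1 is `m`, so `k = 2` and `k + k < n` is `5 ≤ n`.
  (λ n 5≤n → let λs , μs , x , vx , j , h , i , den = vertex-with-denominator 1 n 5≤n
             in λs , μs , x , vx , j , h , i , HasDenominator⇒¬IsInteger ℕₚ.≤-refl den) ,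
  -- Taking `k = D + 1` keeps `k` positive for `D = 0`; the bound is `2 k + 1`.
  (λ D → suc (suc D + suc D) , λ n N≤n →
    let λs , μs , x , vx , j , h , i , den = vertex-with-denominator D n N≤n
    in λs , μs , x , vx , j , h , i , suc D , ℕₚ.n≤1+n D , den) ,
  λ { (suc m) _ → λᵏμᵏ-vertex m }
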